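{- Let $k\geq2$ and $n=2$. Then the conditional matching preclusion number of the DCell is $mp_1(D_{k,2})=2n+2k-4=2k$. Moreover, $D_{k,2}$ is conditionally super matched for $k\geq3$.
   Context: DCell $D_{k,n}$ ($n\geq 2$, $k\geq 0$) is defined recursively. $D_{0,n}$ is the complete graph $K_n$ on vertices $0,1,\dots,n-1$. Let $t_{k,n}=|V(D_{k,n})|$. For $k\geq1$, $D_{k,n}$ is built from $t_{k-1,n}+1$ disjoint copies $D^0_{k-1,n},\dots,D^{t_{k-1,n}}_{k-1,n}$ of $D_{k-1,n}$; a vertex of copy $D^i_{k-1,n}$ is labeled $(i,a_{k-1},\dots,a_0)$, where $(a_{k-1},\dots,a_0)$ is its label in $D_{k-1,n}$, and its index within the copy is $uid_{k-1}=a_0+\sum_{l=1}^{k-1}a_l t_{l-1,n}$. For each pair $a<b$ of copy indices, one edge joins the vertex of $D^a_{k-1,n}$ with $uid_{k-1}=b-1$ to the vertex of $D^b_{k-1,n}$ with $uid_{k-1}=a$. For a graph $G$ of even order, $mp_1(G)$ is the minimum number of edges whose deletion yields a graph with neither a perfect matching nor an isolated vertex. Let $v_e(G)=\min\{d_G(u)+d_G(w)-2-y_G(u,w)\}$ over all pairs $u,w$ that are the ends of a path $u v w$ of length $2$, where $y_G(u,w)=1$ if $uw\in E(G)$ and $0$ otherwise. A trivial optimal conditional solution is, for such a path $uvw$ attaining $v_e(G)$, the set of all edges incident to $u$ or $w$ other than $uv$ and $vw$. $G$ is conditionally super matched if $mp_1(G)=v_e(G)$ and every set of $mp_1(G)$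 edges whose deletion leaves a graph with no perfect matching and no isolated vertex is a trivial optimal conditional solution. -}

module Defs where

open import Data.Nat using (ℕ; zero; suc; _+_; _*_; _∸_; _≤_; _≡ᵇ_; _<ᵇ_)
open import Data.Bool using (Bool; true; false; if_then_else_; not; _∧_; T)
open import Data.Fin using (Fin; toℕ; remQuot)
open import Data.List using (List; length; map; allFin)
open import Data.Nat.ListAction using (sum)
open import Data.List.Membership.Propositional using (_∈_)
open import Data.List.Relation.Unary.All using (All)
open import Data.List.Relation.Unary.AllPairs using (AllPairs)
open import Data.Product using (Σ; _×_; _,_; proj₁; proj₂)
open import Data.Sum using (_⊎_)
open import Relation.Nullary using (¬_)
open import Relation.Binary.PropositionalEquality using (_≡_; _≢_)
open import Function.Bundles using (_⇔_)

t : ℕ → ℕ → ℕ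
t zero    n = n
t (suc k) n = suc (t k n) * t k n

-- Vertices of D_{k,n} are identified with their uid_k ∈ {0,…,t k n - 1}.
-- In D_{k+1,n}, uid = i * t_{k,n} + uid_k, where i is the copy index;
-- `remQuot` splits a uid into (copy index i , uid within the copy).
DCellAdj : (k n : ℕ) → Fin (t k n) → Fin (t k n) → Bool
DCellAdj zero    n x y = not (toℕ x ≡ᵇ toℕ y)
DCellAdj (suc k) n x y =
  if toℕ i ≡ᵇ toℕ i'
    then DCellAdj k n j j'
    else (if toℕ i <ᵇ toℕ i'
      then ((toℕ j ≡ᵇ (toℕ i' ∸ 1)) ∧ (toℕ j' ≡ᵇ toℕ i))
      else ((toℕ j' ≡ᵇ (toℕ i ∸ 1)) ∧ (toℕ j ≡ᵇ toℕ i')))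
  where
  i  = proj₁ (remQuot {suc (t k n)} (t k n) x)
  j  = proj₂ (remQuot {suc (t k n)} (t k n) x)
  i' = proj₁ (remQuot {suc (t k n)} (t k n) y)
  j' = proj₂ (remQuot {suc (t k n)} (t k n) y)

module _ {N : ℕ} (G : Fin N → Fin N → Bool) where

  Edge : Fin N → Fin N → Set
  Edge u v = T (G u v)

  EdgeList : Set
  EdgeList = List (Fin N × Fin N)

  SameEdge : Fin N × Fin N → Fin N × Fin N → Set
  SameEdge (a , b) (c , d) = (a ≡ c × b ≡ d) ⊎ (a ≡ d × b ≡ c)

  InF : EdgeList → Fin N → Fin N → Set
  InF F u v = ((u , v) ∈ F) ⊎ ((v , u) ∈ F)

  -- F is a genuine set of edges of G (no repetitions); |F| = length F
  ValidEdgeSet : EdgeList → Set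
  ValidEdgeSet F = All (λ e → Edge (proj₁ e) (proj₂ e)) F
                 × AllPairs (λ e e' → ¬ SameEdge e e') F

  Removed : EdgeList → Fin N → Fin N → Set
  Removed F u v = Edge u v × ¬ InF F u v

  deg : Fin N → ℕ
  deg u = sum (map (λ v → if G u v then 1 else 0) (allFin N))

  yG : Fin N → Fin N → ℕ
  yG u w = if G u w then 1 else 0

  Path2 : Fin N → Fin N → Fin N → Set
  Path2 u v w = Edge u v × Edge v w × u ≢ w

  veVal : Fin N → Fin N → ℕ
  veVal u w = deg u + deg w ∸ 2 ∸ yG u w

  IsVe : ℕ → Set
  IsVe m = Σ (Fin N) (λ u → Σ (Fin N) (λ v → Σ (Fin N) (λ w → Path2 u v w × veVal u w ≡ m)))
         × (∀ u v w → Path2 u v w → m ≤ veVal u w)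

-- perfect matching of a graph H, as a fixed-point-free partner involution along edges
PerfectMatching : {N : ℕ} → (Fin N → Fin N → Set) → Set
PerfectMatching {N} H = Σ (Fin N → Fin N) (λ m → ∀ u → H u (m u) × m (m u) ≡ u)

Isolated : {N : ℕ} → (Fin N → Fin N → Set) → Fin N → Set
Isolated {N} H u = ∀ (v : Fin N) → ¬ H u v

module _ {N : ℕ} (G : Fin N → Fin N → Bool) where

  CondFaultSet : EdgeList G → Set
  CondFaultSet F = (¬ PerfectMatching (Removed G F)) × (∀ u → ¬ Isolated (Removed G F) u)

  IsMp1 : ℕ → Set
  IsMp1 m = Σ (EdgeList G) (λ F → ValidEdgeSet G F × length F ≡ m × CondFaultSet F)
          × (∀ F → ValidEdgeSet G F → CondFaultSet F → m ≤ length F)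

  TrivialSolution : EdgeList G → Set
  TrivialSolution F =
    Σ (Fin N) λ u → Σ (Fin N) λ v → Σ (Fin N) λ w →
      Path2 G u v w × IsVe G (veVal G u w) ×
      (∀ a b → InF G F a b ⇔
        (Edge G a b × (a ≡ u ⊎ a ≡ w ⊎ b ≡ u ⊎ b ≡ w)
          × ¬ SameEdge G (a , b) (u , v) × ¬ SameEdge G (a , b) (v , w)))

  ConditionallySuperMatched : Set
  ConditionallySuperMatched =
    Σ ℕ λ m → IsMp1 m × IsVe G m ×
      (∀ F → ValidEdgeSet G F → length F ≡ m → CondFaultSet F → TrivialSolution F)

{-# OPTIONS --safe #-}
module Submission where

open import Defs
open import Data.Nat using (ℕ; zero; suc; pred; _+_; _*_; _∸_; _≤_; _<_; s≤s; z≤n; _≡ᵇ_; _<ᵇ_; >-nonZero)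
import Data.Nat.Properties as ℕ
open import Data.Nat.DivMod using (_/_; _%_)
open import Data.Nat.ListAction using (sum)
open import Data.Nat.Tactic.RingSolver using (solve-∀)
open import Data.Bool using (Bool; true; false; if_then_else_; T; _∧_; _∨_)
open import Data.Bool.Properties using (T?; T-∧)
open import Data.Fin using (Fin; zero; suc; toℕ; punchIn; punchOut; splitAt; join; remQuot; combine)
open import Data.Fin.Properties using (_≟_; any?; all?; injective⇒≤; join-splitAt; punchIn-injective;
  punchInᵢ≢i; punchIn-punchOut; suc-injective; remQuot-combine; combine-remQuot; toℕ-injective)
open import Data.List using (List; []; _∷_; _++_; length; lookup; map; allFin; filter; tabulate)
open import Data.List.Properties using (length-++; length-map; length-tabulate)
open import Data.List.Membership.Propositional using (_∈_; _∉_; find)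
open import Data.List.Membership.Propositional.Properties
  using (∈-lookup; ∈-map⁺; ∈-++⁺ˡ; ∈-++⁺ʳ; ∈-++⁻; ∈-tabulate⁺; ∈-tabulate⁻; ∈-filter⁺; ∈-filter⁻; ∈-allFin)
import Data.List.Membership.DecPropositional as DecMembership
import Data.List.Relation.Unary.Any as Any
open Any using (Any; here; there; index)
open import Data.List.Relation.Unary.Any.Properties using (lookup-index)
import Data.List.Relation.Unary.All as All
import Data.List.Relation.Unary.All.Properties as All
open import Data.List.Relation.Unary.All using (All; []; _∷_)
open import Data.List.Relation.Unary.AllPairs using (AllPairs; []; _∷_)
import Data.List.Relation.Unary.AllPairs.Properties as AllPairs
open import Data.List.Relation.Unary.Unique.Propositional using (Unique)
import Data.List.Relation.Unary.Unique.Propositional.Properties as Unique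
import Data.Vec as Vec
open Vec using (Vec; []; _∷_; _[_]≔_; replicate)
open import Data.Product using (Σ; ∃; _×_; _,_; proj₁; proj₂)
open import Data.Product.Properties using (≡-dec; ,-injective)
open import Data.Sum using (_⊎_; inj₁; inj₂; [_,_]′; swap)
open import Data.Unit using (tt)
open import Data.Empty using (⊥; ⊥-elim)
open import Function.Bundles using (mk⇔; Equivalence)
open import Relation.Nullary using (¬_; Dec; yes; no; does)
open import Relation.Nullary.Decidable using (¬?; decidable-stable; _×-dec_; _⊎-dec_; from-yes)
open import Relation.Binary.Definitions using (DecidableEquality)
open import Relation.Binary.PropositionalEquality using (_≡_; _≢_; refl; sym; trans; cong; cong₂; subst)

-- The level-l edges of D_{k,2} form a perfect matching for every l, so D_{k,2} is properly edge-coloured with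
-- k + 1 colours; D_{k+1,2} consists of t + 1 copies of it, any two of them joined by one (cross) edge.
-- Let F be a set of at most 2k + 2 faults of D_{k+1,2}, k ≥ 2, that isolates no vertex. If neither the cross
-- edges nor a choice of one colour per copy avoid F, then F contains a cross edge and meets every colour of some
-- copy i. Counting gives a colour l of which F contains only one edge xy in copy i, and every other copy has
-- a fault-free colour. This yields a matching with the two holes x and y. A hole slides along a good edge and then
-- along the matching edge found there; inside a fault-free copy it moves anywhere, because D_{k,2} is bicritical.
-- So two holes leading into fault-free copies can be brought together through a copy that F does not touch.
-- Since D_{k,2} has no cycles of length 3, 4 or 5, the faults that stop the short slides of a hole are distinct:
-- stopping both holes takes 2k + 3 faults, and stopping x alone takes 2k + 2, hence determines F, which
-- then is the trivial solution. For D_{2,2} three faults are handled, and bicriticality is shown, by computation.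

-- The computation has to start at D_{2,2}: D_{1,2} is a 6-cycle, hence bipartite and not
-- bicritical, so the passage from k to k + 1 has nothing to use below k = 2. From D_{2,2} on,
-- bicriticality is inherited by the same movement of holes, with no faults present. The counts work
-- because any two copies are joined by only one edge. A hole may leave its copy at u if the cross
-- edge at u is good and leads into a fault-free copy, and one fault can spoil this for at most one
-- u in each copy. Every failed slide therefore costs a fault of its own. Listing all 2k + 2 faults
-- does not yet give the trivial solution: each listed fault is either an edge at the current hole
-- or spoils the vertex where a slide would land. Longer slides settle the second kind, until only
-- two shapes remain. In one, the path of the trivial solution lies inside copy i; in the other, x
-- has lost all its edges in copy i and the path begins with the cross edge at x. In both, the fault
-- known to be a cross edge completes the identification.

-- Counting with families of distinct faults

record Distinct {N : ℕ} (n : ℕ) (Q : Fin N → Set) : Set where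
  constructor distinct
  field
    f   : Fin n → Fin N
    inj : ∀ a b → f a ≡ f b → a ≡ b
    sat : ∀ a → Q (f a)

module _ {N : ℕ} where

  abstract
    bound : ∀ {n} {Q : Fin N → Set} → Distinct n Q → n ≤ N
    bound F = injective⇒≤ (λ {a} {b} → Distinct.inj F a b)

  abstract
    single : ∀ {Q : Fin N → Set} e → Q e → Distinct 1 Q
    single e q = distinct (λ _ → e) (λ { zero zero _ → refl }) (λ _ → q)

  -- The hypothesis `apart` makes the chosen witnesses pairwise distinct.
  abstract
    choose : ∀ {n} {S : Fin n → Fin N → Set} → (∀ a → ∃ (S a)) →
             (∀ {a b e} → S a e → S b e → a ≡ b) → Distinct n (λ e → ∃ λ a → S a e)
    choose {S = S} w apart = distinct (λ a → proj₁ (w a))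
      (λ a b eq → apart (proj₂ (w a)) (subst (S b) (sym eq) (proj₂ (w b))))
      (λ a → a , proj₂ (w a))

  _⊕[_]_ : ∀ {n m} {Q R : Fin N → Set} → Distinct n Q → (∀ {e} → Q e → R e → ⊥) → Distinct m R →
           Distinct (n + m) (λ e → Q e ⊎ R e)
  _⊕[_]_ {n} {m} {Q} {R} (distinct f f-inj f-sat) apart (distinct g g-inj g-sat) =
    distinct (λ a → h (splitAt n a)) h-inj (λ a → h-sat (splitAt n a))
    where
    h : Fin n ⊎ Fin m → Fin N
    h = [ f , g ]′
    h-sat : ∀ s → Q (h s) ⊎ R (h s)
    h-sat (inj₁ a) = inj₁ (f-sat a)
    h-sat (inj₂ b) = inj₂ (g-sat b)
    inj-sum : ∀ s s' → h s ≡ h s' → s ≡ s'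
    inj-sum (inj₁ a) (inj₁ b) eq = cong inj₁ (f-inj a b eq)
    inj-sum (inj₁ a) (inj₂ b) eq = ⊥-elim (apart (f-sat a) (subst R (sym eq) (g-sat b)))
    inj-sum (inj₂ a) (inj₁ b) eq = ⊥-elim (apart (f-sat b) (subst R eq (g-sat a)))
    inj-sum (inj₂ a) (inj₂ b) eq = cong inj₂ (g-inj a b eq)
    h-inj : ∀ a b → h (splitAt n a) ≡ h (splitAt n b) → a ≡ b
    h-inj a b eq = trans (sym (join-splitAt n m a))
      (trans (cong (join n m) (inj-sum (splitAt n a) (splitAt n b) eq)) (join-splitAt n m b))

  infixr 5 _⊕[_]_

  abstract
    -- An element outside the family would enlarge it beyond `N`. This turns counting into knowledge
    -- of `F`: once as many distinct faults are known as `F` can contain, every fault is one of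
    -- them.
    exhaust : ∀ {n} {Q : Fin N → Set} → Distinct n Q → N ≤ n → ∀ e → Q e
    exhaust {n} {Q} F N≤n e with any? (λ a → Distinct.f F a ≟ e)
    ... | yes (a , refl) = Distinct.sat F a
    ... | no ∄a = ⊥-elim (ℕ.<-irrefl refl (ℕ.≤-trans (bound larger) N≤n))
      where
      F' : Distinct n (λ e' → e' ≢ e)
      F' = distinct (Distinct.f F) (Distinct.inj F) (λ a eq → ∄a (a , eq))
      larger : Distinct (1 + n) (λ e' → e' ≡ e ⊎ e' ≢ e)
      larger = single e refl ⊕[ (λ p q → q p) ] F'

-- Near-perfect matchings

record NearPerfect {A : Set} (G : A → A → Set) (g h : A) : Set where
  field
    m    : A → A
    g≢h  : g ≢ h
    mg   : m g ≡ g
    mh   : m h ≡ h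
    invo : ∀ u → m (m u) ≡ u
    good : ∀ u → u ≢ g → u ≢ h → G u (m u)

Perfect : {A : Set} → (A → A → Set) → Set
Perfect {A} G = Σ (A → A) λ m → ∀ u → G u (m u) × m (m u) ≡ u

module Moves {A : Set} (_≟A_ : DecidableEquality A) (G : A → A → Set)
             (G-sym : ∀ {u v} → G u v → G v u) (G-irr : ∀ {u} → ¬ G u u) where

  exchange : ∀ {g h} → NearPerfect G g h → NearPerfect G h g
  exchange s = record { m = m ; g≢h = λ p → g≢h (sym p) ; mg = mh ; mh = mg ; invo = invo
                  ; good = λ u p q → good u q p }
    where open NearPerfect s

  abstract
    join-holes : ∀ {g h} → NearPerfect G g h → G g h → Perfect G
    join-holes {g} {h} s gh = m' , λ u → good' u , invo' u
      where
      open NearPerfect s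
      m' : A → A
      m' u with u ≟A g
      ... | yes _ = h
      ... | no _ with u ≟A h
      ...   | yes _ = g
      ...   | no _ = m u
      m'g : m' g ≡ h
      m'g with g ≟A g
      ... | yes _ = refl
      ... | no p = ⊥-elim (p refl)
      m'h : m' h ≡ g
      m'h with h ≟A g
      ... | yes p = ⊥-elim (g≢h (sym p))
      ... | no _ with h ≟A h
      ...   | yes _ = refl
      ...   | no p = ⊥-elim (p refl)
      m'o : ∀ {u} → u ≢ g → u ≢ h → m' u ≡ m u
      m'o {u} p q with u ≟A g
      ... | yes e = ⊥-elim (p e)
      ... | no _ with u ≟A h
      ...   | yes e = ⊥-elim (q e)
      ...   | no _ = refl
      good' : ∀ u → G u (m' u)
      good' u with u ≟A g
      ... | yes refl = gh
      ... | no p with u ≟A h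
      ...   | yes refl = G-sym gh
      ...   | no q = good u p q
      invo' : ∀ u → m' (m' u) ≡ u
      invo' u with u ≟A g
      ... | yes refl = m'h
      ... | no p with u ≟A h
      ...   | yes refl = m'g
      ...   | no q = trans (m'o (λ e → p (trans (sym (invo u)) (trans (cong m e) mg)))
                                (λ e → q (trans (sym (invo u)) (trans (cong m e) mh)))) (invo u)

  abstract
    -- There is no matching edge at the other hole, so `z` must differ from it; in the excluded case
    -- `join-holes` applies. The second component says that only three vertices are affected, which
    -- is what makes consecutive slides composable.
    slide : ∀ {g h} (s : NearPerfect G g h) z z₂ → NearPerfect.m s z ≡ z₂ → G g z → z ≢ h →
            Σ (NearPerfect G z₂ h) λ s' → ∀ u → u ≢ g → u ≢ z → u ≢ z₂ → NearPerfect.m s' u ≡ NearPerfect.m s u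
    slide {g} {h} s z z₂ mz gz z≢h = record
        { m = m' ; g≢h = z₂≢h ; mg = m'z₂ ; mh = m'h ; invo = invo' ; good = good' } ,
        λ u p q r → m'o p q r
      where
      open NearPerfect s
      z≢g : z ≢ g
      z≢g refl = G-irr gz
      mz₂ : m z₂ ≡ z
      mz₂ = trans (cong m (sym mz)) (invo z)
      z₂≢h : z₂ ≢ h
      z₂≢h refl = z≢h (trans (sym mz₂) mh)
      z₂≢g : z₂ ≢ g
      z₂≢g refl = z≢g (trans (sym mz₂) mg)
      z₂≢z : z₂ ≢ z
      z₂≢z refl = G-irr (subst (G z₂) mz (good z₂ z₂≢g z₂≢h))
      m' : A → A
      m' u with u ≟A g
      ... | yes _ = z
      ... | no _ with u ≟A z
      ...   | yes _ = g
      ...   | no _ with u ≟A z₂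
      ...     | yes _ = z₂
      ...     | no _ = m u
      m'g : m' g ≡ z
      m'g with g ≟A g
      ... | yes _ = refl
      ... | no p = ⊥-elim (p refl)
      m'z : m' z ≡ g
      m'z with z ≟A g
      ... | yes p = ⊥-elim (z≢g p)
      ... | no _ with z ≟A z
      ...   | yes _ = refl
      ...   | no p = ⊥-elim (p refl)
      m'z₂ : m' z₂ ≡ z₂
      m'z₂ with z₂ ≟A g
      ... | yes p = ⊥-elim (z₂≢g p)
      ... | no _ with z₂ ≟A z
      ...   | yes p = ⊥-elim (z₂≢z p)
      ...   | no _ with z₂ ≟A z₂
      ...     | yes _ = refl
      ...     | no p = ⊥-elim (p refl)
      m'o : ∀ {u} → u ≢ g → u ≢ z → u ≢ z₂ → m' u ≡ m u
      m'o {u} p q r with u ≟A g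
      ... | yes e = ⊥-elim (p e)
      ... | no _ with u ≟A z
      ...   | yes e = ⊥-elim (q e)
      ...   | no _ with u ≟A z₂
      ...     | yes e = ⊥-elim (r e)
      ...     | no _ = refl
      m'h : m' h ≡ h
      m'h = trans (m'o (λ p → g≢h (sym p)) (λ p → z≢h (sym p)) (λ p → z₂≢h (sym p))) mh
      good' : ∀ u → u ≢ z₂ → u ≢ h → G u (m' u)
      good' u p q with u ≟A g
      ... | yes refl = gz
      ... | no a with u ≟A z
      ...   | yes refl = G-sym gz
      ...   | no _ with u ≟A z₂
      ...     | yes e = ⊥-elim (p e)
      ...     | no _ = good u a q
      invo' : ∀ u → m' (m' u) ≡ u
      invo' u with u ≟A g
      ... | yes refl = m'z
      ... | no p with u ≟A z
      ...   | yes refl = m'g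
      ...   | no q with u ≟A z₂
      ...     | yes refl = m'z₂
      ...     | no r = trans (m'o (λ e → p (trans (sym (invo u)) (trans (cong m e) mg)))
                                  (λ e → r (trans (sym (invo u)) (trans (cong m e) mz)))
                                  (λ e → q (trans (sym (invo u)) (trans (cong m e) mz₂)))) (invo u)

  abstract
    -- The edge between `x` and `y` may be a fault, since goodness of `M` is asked only elsewhere: a
    -- colour with a single fault still gives a matching with two holes.
    cut : (M : A → A) (x y : A) → x ≢ y → M x ≡ y → (∀ u → M (M u) ≡ u) →
          (∀ u → u ≢ x → u ≢ y → G u (M u)) →
          Σ (NearPerfect G x y) λ s → ∀ u → u ≢ x → u ≢ y → NearPerfect.m s u ≡ M u
    cut M x y x≢y Mx M-invo M-good = record
        { m = m ; g≢h = x≢y ; mg = mx ; mh = my ; invo = invo ; good = good } , λ u p q → mo p q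
      where
      My : M y ≡ x
      My = trans (cong M (sym Mx)) (M-invo x)
      m : A → A
      m u with u ≟A x
      ... | yes _ = u
      ... | no _ with u ≟A y
      ...   | yes _ = u
      ...   | no _ = M u
      mx : m x ≡ x
      mx with x ≟A x
      ... | yes _ = refl
      ... | no p = ⊥-elim (p refl)
      my : m y ≡ y
      my with y ≟A x
      ... | yes _ = refl
      ... | no _ with y ≟A y
      ...   | yes _ = refl
      ...   | no p = ⊥-elim (p refl)
      mo : ∀ {u} → u ≢ x → u ≢ y → m u ≡ M u
      mo {u} p q with u ≟A x
      ... | yes e = ⊥-elim (p e)
      ... | no _ with u ≟A y
      ...   | yes e = ⊥-elim (q e)
      ...   | no _ = refl
      good : ∀ u → u ≢ x → u ≢ y → G u (m u)
      good u p q = subst (G u) (sym (mo p q)) (M-good u p q)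
      invo : ∀ u → m (m u) ≡ u
      invo u with u ≟A x
      ... | yes refl = mx
      ... | no p with u ≟A y
      ...   | yes refl = my
      ...   | no q = trans (mo (λ e → q (trans (sym (M-invo u)) (trans (cong M e) Mx)))
                               (λ e → p (trans (sym (M-invo u)) (trans (cong M e) My)))) (M-invo u)

-- An r-regular graph of girth at least 6, given by a decomposition into r perfect matchings ν c.
record Coloured (A : Set) (r : ℕ) : Set where
  field
    ν     : Fin r → A → A
    ν-inv : ∀ c u → ν c (ν c u) ≡ u
    ν-irr : ∀ c u → ν c u ≢ u
    ν-col : ∀ {c d u} → ν c u ≡ ν d u → c ≡ d

  E : A → A → Set
  E u v = ∃ λ c → ν c u ≡ v

  field
    -- A closed walk of length 3 or 5 contains a cycle of length 3 or 5, so `no3` and `no5` ask for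
    -- no distinctness. A closed walk of length 4 may merely backtrack, which the two inequalities
    -- of `no4` exclude.
    no3 : ∀ {a b c} → E a b → E b c → E c a → ⊥
    no4 : ∀ {a b c d} → E a b → E b c → E c d → E d a → a ≢ c → b ≢ d → ⊥
    no5 : ∀ {a b c d e} → E a b → E b c → E c d → E d e → E e a → ⊥

  edge : ∀ c u → E u (ν c u)
  edge c u = c , refl

  E-sym : ∀ {u v} → E u v → E v u
  E-sym (c , refl) = c , ν-inv c _

  edge⁻ : ∀ c u → E (ν c u) u
  edge⁻ c u = E-sym (edge c u)

  ν-inj : ∀ {c u v} → ν c u ≡ ν c v → u ≡ v
  ν-inj {c} {u} {v} p = trans (sym (ν-inv c u)) (trans (cong (ν c) p) (ν-inv c v))

Bicritical : ∀ {A r} → Coloured A r → Set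
Bicritical {A} H = ∀ {x y : A} → x ≢ y → NearPerfect (Coloured.E H) x y

-- The recursive step of the construction

module Cross (T : ℕ) where
  P : Set
  P = Fin (suc T) × Fin T

  -- Vertex `j` of copy `i` leads to the `j`-th of the copies other than `i`, and arrives at the
  -- vertex whose number is the rank of `i` among the copies other than the target. For a < b this
  -- pairs vertex b - 1 of copy a with vertex a of copy b.
  χ : P → P
  χ (i , j) = punchIn i j , punchOut (punchInᵢ≢i i j)

  tgt : P → Fin (suc T)
  tgt u = proj₁ (χ u)

  tgt-χ : ∀ u → tgt (χ u) ≡ proj₁ u
  tgt-χ (i , j) = punchIn-punchOut (punchInᵢ≢i i j)

  tgt≢ : ∀ u → tgt u ≢ proj₁ u
  tgt≢ (i , j) = punchInᵢ≢i i j

  -- Two copies are joined by one edge only. Both `χ-inv` and the girth of the product rest on this.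
  tgt-inj : ∀ {u v} → proj₁ u ≡ proj₁ v → tgt u ≡ tgt v → u ≡ v
  tgt-inj {i , j} {.i , j'} refl q = cong (i ,_) (punchIn-injective i j j' q)

  χ-inv : ∀ u → χ (χ u) ≡ u
  χ-inv u = tgt-inj (tgt-χ u) (tgt-χ (χ u))

  χ-irr : ∀ u → χ u ≢ u
  χ-irr u p = tgt≢ u (cong proj₁ p)

  port : ∀ {i i'} → i ≢ i' → ∃ λ j → tgt (i , j) ≡ i'
  port p = punchOut p , punchIn-punchOut p

module Product {T r : ℕ} (H : Coloured (Fin T) r) where
  open Cross T public
  private module H = Coloured H

  N : Fin (suc r) → P → P
  N zero u = χ u
  N (suc c) (i , j) = i , H.ν c j

  N-inv : ∀ c u → N c (N c u) ≡ u
  N-inv zero u = χ-inv u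
  N-inv (suc c) (i , j) = cong (i ,_) (H.ν-inv c j)

  N-irr : ∀ c u → N c u ≢ u
  N-irr zero u = χ-irr u
  N-irr (suc c) (i , j) p = H.ν-irr c j (cong proj₂ p)

  N-col : ∀ {c d u} → N c u ≡ N d u → c ≡ d
  N-col {zero} {zero} p = refl
  N-col {zero} {suc d} {u} p = ⊥-elim (tgt≢ u (cong proj₁ p))
  N-col {suc c} {zero} {u} p = ⊥-elim (tgt≢ u (sym (cong proj₁ p)))
  N-col {suc c} {suc d} {i , j} p = cong suc (H.ν-col (cong proj₂ p))

  EP : P → P → Set
  EP u v = ∃ λ c → N c u ≡ v

  private
    data View (u v : P) : Set where
      inside : proj₁ u ≡ proj₁ v → H.E (proj₂ u) (proj₂ v) → View u v
      cross  : v ≡ χ u → View u v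

    view : ∀ {u v} → EP u v → View u v
    view (zero , refl) = cross refl
    view (suc c , refl) = inside refl (c , refl)

    back : ∀ {u v} → v ≡ χ u → u ≡ χ v
    back {u} refl = sym (χ-inv u)

    irr : ∀ {u} → ¬ EP u u
    irr (c , p) = N-irr c _ p

    far : ∀ {a b} → b ≡ χ a → proj₁ b ≡ proj₁ a → ⊥
    far {a} refl p = tgt≢ a p

    same-port : ∀ {a b c d} → b ≡ χ a → d ≡ χ c → proj₁ a ≡ proj₁ c → proj₁ b ≡ proj₁ d → a ≡ c
    same-port refl refl p q = tgt-inj p q

    -- Here and in `4-cross` and `5-cross` the closed walk is rotated so that it starts with a cross
    -- edge. It has to come back by a cross edge as well. Consecutive cross edges retrace each
    -- other; separated ones join the same two copies, so they coincide by `same-port` and an edge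
    -- between them becomes a loop.
    3-cross : ∀ {a b c} → b ≡ χ a → EP b c → EP c a → ⊥
    3-cross p bc ca with view bc | view ca
    ... | inside q _ | inside r _ = far p (trans q r)
    ... | inside q _ | cross r = irr (subst (EP _) (trans (back r) (sym p)) bc)
    ... | cross q | _ = irr (subst (λ v → EP v _) (trans q (sym (back p))) ca)

    4-cross : ∀ {a b c d} → b ≡ χ a → EP b c → EP c d → EP d a → a ≢ c → b ≢ d → ⊥
    4-cross p bc cd da a≢c b≢d with view bc | view cd | view da
    ... | cross q | _ | _ = a≢c (trans (back p) (sym q))
    ... | inside _ _ | _ | cross s = b≢d (trans p (sym (back s)))
    ... | inside q _ | inside r _ | inside s _ = far p (trans q (trans r s))
    ... | inside q _ | cross r | inside s _ =
      irr (subst (EP _) (sym (same-port (back p) r q (sym s))) bc)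

    5-cross : ∀ {a b c d e} → b ≡ χ a → EP b c → EP c d → EP d e → EP e a →
              (∀ {a b c} → EP a b → EP b c → EP c a → ⊥) → ⊥
    5-cross {a} {b} {c} {d} {e} p bc cd de ea tri with view bc | view cd | view de | view ea
    ... | cross q | _ | _ | _ = tri cd de (subst (EP e) (trans (back p) (sym q)) ea)
    ... | inside _ _ | _ | _ | cross s = tri bc cd (subst (EP d) (trans (back s) (sym p)) de)
    ... | inside q _ | inside r _ | inside s _ | inside t _ = far p (trans q (trans r (trans s t)))
    ... | inside q _ | cross r | inside s _ | inside t _ =
      irr (subst (EP _) (sym (same-port (back p) r q (sym (trans s t)))) bc)
    ... | inside q _ | inside r _ | cross s | inside t _ =
      irr (subst (EP e) (trans (back p) (trans (cong χ (same-port (back p) s (trans q r) (sym t))) (sym s))) ea)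
    ... | inside q _ | cross r | cross s | inside t _ =
      far p (trans q (trans (cong proj₁ (trans (back r) (sym s))) t))

  N-no3 : ∀ {a b c} → EP a b → EP b c → EP c a → ⊥
  N-no3 ab bc ca with view ab | view bc | view ca
  ... | cross p | _ | _ = 3-cross p bc ca
  ... | _ | cross p | _ = 3-cross p ca ab
  ... | _ | _ | cross p = 3-cross p ab bc
  ... | inside _ p | inside _ q | inside _ r = H.no3 p q r

  N-no4 : ∀ {a b c d} → EP a b → EP b c → EP c d → EP d a → a ≢ c → b ≢ d → ⊥
  N-no4 {a} {b} {c} {d} ab bc cd da a≢c b≢d with view ab | view bc | view cd | view da
  ... | cross p | _ | _ | _ = 4-cross p bc cd da a≢c b≢d
  ... | _ | cross p | _ | _ = 4-cross p cd da ab b≢d (λ e → a≢c (sym e))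
  ... | _ | _ | cross p | _ = 4-cross p da ab bc (λ e → a≢c (sym e)) (λ e → b≢d (sym e))
  ... | _ | _ | _ | cross p = 4-cross p ab bc cd (λ e → b≢d (sym e)) a≢c
  ... | inside i p | inside j q | inside k r | inside _ s = H.no4 p q r s
    (λ e → a≢c (cong₂ _,_ (trans i j) e)) (λ e → b≢d (cong₂ _,_ (trans j k) e))

  N-no5 : ∀ {a b c d e} → EP a b → EP b c → EP c d → EP d e → EP e a → ⊥
  N-no5 ab bc cd de ea with view ab | view bc | view cd | view de | view ea
  ... | cross p | _ | _ | _ | _ = 5-cross p bc cd de ea N-no3
  ... | _ | cross p | _ | _ | _ = 5-cross p cd de ea ab N-no3
  ... | _ | _ | cross p | _ | _ = 5-cross p de ea ab bc N-no3
  ... | _ | _ | _ | cross p | _ = 5-cross p ea ab bc cd N-no3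
  ... | _ | _ | _ | _ | cross p = 5-cross p ab bc cd de N-no3
  ... | inside _ p | inside _ q | inside _ r | inside _ s | inside _ t = H.no5 p q r s t

  product : Coloured P (suc r)
  product = record { ν = N ; ν-inv = N-inv ; ν-irr = N-irr ; ν-col = λ {c} {d} {u} → N-col {c} {d} {u}
                   ; no3 = N-no3 ; no4 = N-no4 ; no5 = N-no5 }

abstract
  avoid : ∀ {n} (L : List (Fin n)) → length L < n → ∃ (_∉ L)
  avoid {n} L short with any? (λ c → ¬? (DecMembership._∈?_ _≟_ c L))
  ... | yes p = p
  ... | no ∄c = ⊥-elim (ℕ.<⇒≱ short (injective⇒≤ (λ {c} {d} → index-inj c d)))
    where
    mem : ∀ c → c ∈ L
    mem c = decidable-stable (DecMembership._∈?_ _≟_ c L) (λ c∉ → ∄c (c , c∉))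
    index-inj : ∀ c d → index (mem c) ≡ index (mem d) → c ≡ d
    index-inj c d eq = trans (lookup-index (mem c)) (trans (cong (lookup L) eq) (sym (lookup-index (mem d))))

-- Faults of an edge-coloured graph

module Faults {A : Set} {r : ℕ} (G : Coloured A r) (_≟A_ : DecidableEquality A) (F : List (A × A)) where
  private
    module G = Coloured G

  Fault : Set
  Fault = Fin (length F)

  IsEdge : Fault → A → A → Set
  IsEdge e u v = lookup F e ≡ (u , v) ⊎ lookup F e ≡ (v , u)

  By : A → Fin r → Fault → Set
  By u c e = IsEdge e u (G.ν c u)

  Hit : A → Fin r → Set
  Hit u c = ∃ (By u c)

  by? : ∀ u c e → Dec (By u c e)
  by? u c e = ≡-dec _≟A_ _≟A_ (lookup F e) (u , G.ν c u) ⊎-dec ≡-dec _≟A_ _≟A_ (lookup F e) (G.ν c u , u)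

  abstract
    hit? : ∀ u c → Dec (Hit u c)
    hit? u c = any? (by? u c)

  Good : A → A → Set
  Good u v = ∃ λ c → G.ν c u ≡ v × ¬ Hit u c

  By-rev : ∀ {u c e} → By (G.ν c u) c e → By u c e
  By-rev {u} {c} {e} p = swap (subst (IsEdge e (G.ν c u)) (G.ν-inv c u) p)

  -- The pair stored at `e` determines an edge, hence its colour and its two ends, in whichever
  -- orientation it is stored.
  By-uniq : ∀ {u c v d e} → By u c e → By v d e → (c ≡ d) × (u ≡ v ⊎ G.ν c u ≡ v)
  By-uniq {u} {c} {v} {d} (inj₁ p) (inj₁ q) with ,-injective (trans (sym p) q)
  ... | refl , b = G.ν-col {c} {d} {u} b , inj₁ refl
  By-uniq {u} {c} {v} {d} (inj₁ p) (inj₂ q) with ,-injective (trans (sym p) q)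
  ... | a , refl = G.ν-col {c} {d} {G.ν c u} (trans (G.ν-inv c u) a) , inj₂ refl
  By-uniq {u} {c} {v} {d} (inj₂ p) (inj₁ q) with ,-injective (trans (sym p) q)
  ... | refl , a = G.ν-col {c} {d} {G.ν c u} (trans (G.ν-inv c u) a) , inj₂ refl
  By-uniq {u} {c} {v} {d} (inj₂ p) (inj₂ q) with ,-injective (trans (sym p) q)
  ... | b , refl = G.ν-col {c} {d} {u} b , inj₁ refl

  -- With v = ν c u and w = ν c' v: the faults are all edges at u and at w other than uv and vw.
  record Star : Set where
    field
      centre : A
      c c'   : Fin r
      c≢c'   : c ≢ c'
      cover  : ∀ e → (∃ λ d → d ≢ c × By centre d e) ⊎ (∃ λ d → d ≢ c' × By (G.ν c' (G.ν c centre)) d e)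
      hit-u  : ∀ d → d ≢ c → Hit centre d
      hit-w  : ∀ d → d ≢ c' → Hit (G.ν c' (G.ν c centre)) d
      size   : pred r + pred r ≤ length F

-- Holes moving between copies

module Faulty {T r : ℕ} (H : Coloured (Fin T) r) (bc : Bicritical H) (F : List (Cross.P T × Cross.P T)) where
  open Product H public
  module H = Coloured H

  cp : P → Fin (suc T)
  cp = proj₁

  _≟P_ : DecidableEquality P
  _≟P_ = ≡-dec _≟_ _≟_

  open Faults product _≟P_ F public

  Good-sym : ∀ {u v} → Good u v → Good v u
  Good-sym {u} (c , refl , p) = c , N-inv c u , λ { (e , q) → p (e , By-rev q) }

  Good-irr : ∀ {u} → ¬ Good u u
  Good-irr {u} (c , p , _) = N-irr c u p

  open Moves _≟P_ Good Good-sym Good-irr public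

  Ins : Fin (suc T) → Fault → Set
  Ins b e = cp (proj₁ (lookup F e)) ≡ b × cp (proj₂ (lookup F e)) ≡ b

  -- A fault that makes it unsafe for a hole at u to leave its copy.
  Kill : P → Fault → Set
  Kill u e = By u zero e ⊎ Ins (tgt u) e

  Free : P → Set
  Free u = ∀ e → ¬ Kill u e

  abstract
    kill? : ∀ u e → Dec (Kill u e)
    kill? u e = by? u zero e
      ⊎-dec ins? where
      ins? : Dec (Ins (tgt u) e)
      ins? with cp (proj₁ (lookup F e)) ≟ tgt u | cp (proj₂ (lookup F e)) ≟ tgt u
      ... | yes p | yes q = yes (p , q)
      ... | no p | _ = no (λ x → p (proj₁ x))
      ... | yes _ | no q = no (λ x → q (proj₂ x))

  abstract
    free? : ∀ u → Free u ⊎ ∃ (Kill u)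
    free? u with any? (kill? u)
    ... | yes p = inj₂ p
    ... | no p = inj₁ (λ e q → p (e , q))

  By-Ins : ∀ {b w c e} → By (b , w) (suc c) e → Ins b e
  By-Ins (inj₁ p) = cong (λ q → cp (proj₁ q)) p , cong (λ q → cp (proj₂ q)) p
  By-Ins (inj₂ p) = cong (λ q → cp (proj₁ q)) p , cong (λ q → cp (proj₂ q)) p

  Ins-uniq : ∀ {b b' e} → Ins b e → Ins b' e → b ≡ b'
  Ins-uniq (p , _) (q , _) = trans (sym p) q

  cross≢Ins : ∀ {u b e} → By u zero e → ¬ Ins b e
  cross≢Ins {u} (inj₁ p) (q , s) = tgt≢ u (trans (sym (cong (λ q → cp (proj₂ q)) p)) (trans s
    (trans (sym q) (cong (λ q → cp (proj₁ q)) p))))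
  cross≢Ins {u} (inj₂ p) (q , s) = tgt≢ u (trans (sym (cong (λ q → cp (proj₁ q)) p)) (trans q
    (trans (sym s) (cong (λ q → cp (proj₂ q)) p))))

  -- A cross edge has at most one end in a given copy, and a fault inside another copy is met only
  -- through the single edge leading there. Hence distinct killed vertices of one copy need distinct
  -- faults.
  Kill-uniq : ∀ {u v e} → cp u ≡ cp v → Kill u e → Kill v e → u ≡ v
  Kill-uniq {u} eq (inj₁ p) (inj₁ q) with proj₂ (By-uniq {u} {zero} {_} {zero} p q)
  ... | inj₁ r = r
  ... | inj₂ r = ⊥-elim (tgt≢ u (trans (cong cp r) (sym eq)))
  Kill-uniq {u} eq (inj₁ p) (inj₂ q) = ⊥-elim (cross≢Ins {u} p q)
  Kill-uniq {v = v} eq (inj₂ p) (inj₁ q) = ⊥-elim (cross≢Ins {v} q p)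
  Kill-uniq eq (inj₂ p) (inj₂ q) = tgt-inj eq (Ins-uniq p q)

  Kill≢Ins : ∀ {u e} → Kill u e → ¬ Ins (cp u) e
  Kill≢Ins {u} (inj₁ p) q = cross≢Ins {u} p q
  Kill≢Ins {u} (inj₂ p) q = tgt≢ u (Ins-uniq p q)

  free-good : ∀ {u} → Free u → Good u (χ u)
  free-good fr = zero , refl , λ { (e , p) → fr e (inj₁ p) }

  -- `teleport` discards the matching inside copy `b` altogether, so no matching edge may leave that
  -- copy.
  Pres : ∀ {g h} → NearPerfect Good g h → Fin (suc T) → Set
  Pres s b = ∀ u → cp u ≡ b → cp (NearPerfect.m s u) ≡ b

  -- The hole g enters the fault-free copy b at χ g; bicriticality lets it leave at any other (b , w).
  abstract
    teleport : ∀ {g h} (s : NearPerfect Good g h) b w → tgt g ≡ b → Free g → Pres s b → cp h ≢ b → (b , w) ≢ χ g →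
               Σ (NearPerfect Good (b , w) h) λ s' → ∀ u → cp u ≢ b → u ≢ g → NearPerfect.m s' u ≡ NearPerfect.m s u
    teleport {g} {h} s .(tgt g) w refl fr pres h∉b w≢z = record
        { m = m' ; g≢h = λ { refl → h∉b refl } ; mg = m'w ; mh = m'h ; invo = invo' ; good = good' } ,
        λ u p q → m'o p q
      where
      open NearPerfect s
      b : Fin (suc T)
      b = tgt g
      z : Fin T
      z = proj₂ (χ g)
      inner : NearPerfect H.E z w
      inner = bc (λ { refl → w≢z refl })
      n : Fin T → Fin T
      n = NearPerfect.m inner
      clean : ∀ e → ¬ Ins b e
      clean e p = fr e (inj₂ p)
      m' : P → P
      m' u with u ≟P g
      ... | yes _ = χ g
      ... | no _ with cp u ≟ b
      ...   | no _ = m u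
      ...   | yes _ with proj₂ u ≟ z
      ...     | yes _ = g
      ...     | no _ = b , n (proj₂ u)
      m'g : m' g ≡ χ g
      m'g with g ≟P g
      ... | yes _ = refl
      ... | no p = ⊥-elim (p refl)
      m'o : ∀ {u} → cp u ≢ b → u ≢ g → m' u ≡ m u
      m'o {u} p q with u ≟P g
      ... | yes e = ⊥-elim (q e)
      ... | no _ with cp u ≟ b
      ...   | no _ = refl
      ...   | yes e = ⊥-elim (p e)
      m'z : m' (χ g) ≡ g
      m'z with χ g ≟P g
      ... | yes e = ⊥-elim (χ-irr g e)
      ... | no _ with b ≟ b
      ...   | no p = ⊥-elim (p refl)
      ...   | yes _ with z ≟ z
      ...     | yes _ = refl
      ...     | no p = ⊥-elim (p refl)
      m'b : ∀ {v} → v ≢ z → m' (b , v) ≡ (b , n v)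
      m'b {v} p with (b , v) ≟P g
      ... | yes e = ⊥-elim (tgt≢ g (cong cp e))
      ... | no _ with b ≟ b
      ...   | no q = ⊥-elim (q refl)
      ...   | yes _ with v ≟ z
      ...     | yes e = ⊥-elim (p e)
      ...     | no _ = refl
      w≢z' : w ≢ z
      w≢z' refl = w≢z refl
      m'w : m' (b , w) ≡ (b , w)
      m'w = trans (m'b w≢z') (cong (b ,_) (NearPerfect.mh inner))
      m'h : m' h ≡ h
      m'h = trans (m'o h∉b (λ e → g≢h (sym e))) mh
      nz : ∀ {v} → v ≢ z → n v ≢ z
      nz p e = p (trans (sym (NearPerfect.invo inner _)) (trans (cong n e) (NearPerfect.mg inner)))
      good' : ∀ u → u ≢ (b , w) → u ≢ h → Good u (m' u)
      good' u p q with u ≟P g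
      ... | yes refl = free-good fr
      ... | no u≢g with cp u ≟ b
      ...   | no _ = good u u≢g q
      ...   | yes refl with proj₂ u ≟ z
      ...     | yes refl = Good-sym (free-good fr)
      ...     | no u≢z with NearPerfect.good inner (proj₂ u) u≢z (λ { refl → p refl })
      ...       | c , eq = suc c , cong (cp u ,_) eq , λ { (e , x) → clean e (By-Ins {c = c} x) }
      invo' : ∀ u → m' (m' u) ≡ u
      invo' u with u ≟P g
      ... | yes refl = m'z
      ... | no u≢g with cp u ≟ b
      ...   | no u∉b = trans (m'o (λ e → u∉b (trans (sym (cong cp (invo u))) (pres (m u) e)))
                                  (λ e → u≢g (trans (sym (invo u)) (trans (cong m e) mg)))) (invo u)
      ...   | yes refl with proj₂ u ≟ z
      ...     | yes refl = m'g
      ...     | no u≢z = trans (m'b (nz u≢z)) (cong (b ,_) (NearPerfect.invo inner (proj₂ u)))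

  -- A copy untouched by F routes one hole to the other.
  module Routing (room : length F + (length F + 4) < suc T) where

    ends₁ ends₂ : List (Fin (suc T))
    ends₁ = map (λ e → cp (proj₁ e)) F
    ends₂ = map (λ e → cp (proj₂ e)) F

    abstract
      -- Each fault touches at most two copies and four more are excluded explicitly; `room` is
      -- exactly this count.
      untouched : ∀ b₁ b₂ b₃ b₄ → ∃ λ c → (c ≢ b₁ × c ≢ b₂ × c ≢ b₃ × c ≢ b₄) ×
                  (∀ e → cp (proj₁ (lookup F e)) ≢ c × cp (proj₂ (lookup F e)) ≢ c)
      untouched b₁ b₂ b₃ b₄ with avoid (ends₁ ++ ends₂ ++ b₁ ∷ b₂ ∷ b₃ ∷ b₄ ∷ []) short
        where
        short : length (ends₁ ++ ends₂ ++ b₁ ∷ b₂ ∷ b₃ ∷ b₄ ∷ []) < suc T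
        short = subst (_< suc T) (sym (trans (length-++ ends₁) (cong₂ _+_ (length-map _ F)
          (trans (length-++ ends₂) (cong (_+ 4) (length-map _ F)))))) room
      ... | c , c∉ = c , ( (λ { refl → c∉ (extra (here refl)) })
                         , (λ { refl → c∉ (extra (there (here refl))) })
                         , (λ { refl → c∉ (extra (there (there (here refl)))) })
                         , (λ { refl → c∉ (extra (there (there (there (here refl))))) }) )
                     , λ e → (λ { refl → c∉ (∈-++⁺ˡ (∈-map⁺ (λ e → cp (proj₁ e)) (∈-lookup {xs = F} e))) })
                           , (λ { refl → c∉ (∈-++⁺ʳ ends₁ (∈-++⁺ˡ (∈-map⁺ (λ e → cp (proj₂ e)) (∈-lookup {xs = F} e)))) })
        where
        extra : ∀ {c} → c ∈ b₁ ∷ b₂ ∷ b₃ ∷ b₄ ∷ [] → c ∈ ends₁ ++ ends₂ ++ b₁ ∷ b₂ ∷ b₃ ∷ b₄ ∷ []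
        extra p = ∈-++⁺ʳ ends₁ (∈-++⁺ʳ ends₂ p)

    Untouched : Fin (suc T) → Set
    Untouched c = ∀ e → cp (proj₁ (lookup F e)) ≢ c × cp (proj₂ (lookup F e)) ≢ c

    into-untouched : ∀ {u} → Untouched (tgt u) → Free u
    into-untouched {u} un e (inj₁ (inj₁ p)) = proj₂ (un e) (cong (λ q → cp (proj₂ q)) p)
    into-untouched {u} un e (inj₁ (inj₂ p)) = proj₁ (un e) (cong (λ q → cp (proj₁ q)) p)
    into-untouched un e (inj₂ p) = proj₁ (un e) (proj₁ p)

    abstract
      -- Both holes lead into the same fault-free copy. The first enters it at `χ g` and leaves at
      -- `χ h`, which is joined to the second by a good edge.
      meet : ∀ {g h} (s : NearPerfect Good g h) → Free g → Free h → tgt g ≡ tgt h → cp h ≢ tgt g →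
             Pres s (tgt g) → Perfect Good
      meet {g} {h} s fg fh eq h∉ pres with
        teleport s (tgt g) (proj₂ (χ h)) refl fg pres h∉
          (λ p → NearPerfect.g≢h s (trans (sym (χ-inv g)) (trans (cong χ (sym (trans (cong (_, proj₂ (χ h)) (sym eq)) p))) (χ-inv h))))
      ... | s' , _ = join-holes s' (subst (λ b → Good (b , proj₂ (χ h)) h) (sym eq) (Good-sym (free-good fh)))

    abstract
      -- The matching may have been disturbed in `i` and in `a`, the copy that a hole entered by a
      -- slide; `a` is taken to be `i` if there was none. If the holes lead into different copies,
      -- the first passes through its own target and an untouched copy, and so comes to lead into
      -- the target of the second.
      endgame : ∀ {g h} (s : NearPerfect Good g h) i a → (cp g ≡ i ⊎ cp g ≡ a) → (cp h ≡ i ⊎ cp h ≡ a) →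
                Free g → Free h → tgt g ≢ i → tgt g ≢ a → tgt h ≢ i → tgt h ≢ a →
                (∀ b → b ≢ i → b ≢ a → Pres s b) → Perfect Good
      endgame {g} {h} s i a g∈ h∈ fg fh b≢i b≢a b'≢i b'≢a pres
        with tgt g ≟ tgt h
      ... | yes eq = meet s fg fh eq (out h∈ b≢i b≢a) (pres _ b≢i b≢a)
        where
        out : ∀ {j b} → (j ≡ i ⊎ j ≡ a) → b ≢ i → b ≢ a → j ≢ b
        out (inj₁ refl) p _ q = p (sym q)
        out (inj₂ refl) _ p q = p (sym q)
      ... | no b≢b' with untouched i a (tgt g) (tgt h)
      ...   | c , (c≢i , c≢a , c≢b , c≢b') , un = done
        where
        b b' : Fin (suc T)
        b = tgt g
        b' = tgt h
        out : ∀ {j b} → (j ≡ i ⊎ j ≡ a) → b ≢ i → b ≢ a → j ≢ b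
        out (inj₁ refl) p _ q = p (sym q)
        out (inj₂ refl) _ p q = p (sym q)
        p : ∃ λ j → tgt (b , j) ≡ c
        p = port {b} {c} (λ q → c≢b (sym q))
        q : ∃ λ j → tgt (c , j) ≡ b'
        q = port {c} {b'} c≢b'
        done : Perfect Good
        done with teleport s b (proj₁ p) refl fg (pres b b≢i b≢a) (out h∈ b≢i b≢a)
                    (λ e → out g∈ c≢i c≢a (trans (sym (tgt-χ g)) (trans (cong tgt (sym e)) (proj₂ p))))
        ... | s₁ , same₁ with teleport s₁ c (proj₁ q) (proj₂ p)
                    (into-untouched {b , proj₁ p} (subst Untouched (sym (proj₂ p)) un))
                    (λ u e → trans (cong cp (same₁ u (λ e' → c≢b (trans (sym e) e')) λ { refl → out g∈ c≢i c≢a e }))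
                                   (pres c c≢i c≢a u e))
                    (out h∈ c≢i c≢a)
                    (λ e → b≢b' (trans (sym (tgt-χ (b , proj₁ p))) (trans (cong tgt (sym e)) (proj₂ q))))
        ...   | s₂ , same₂ = meet s₂ free₂ fh (proj₂ q) (λ e → tgt≢ h (trans (sym (proj₂ q)) (sym e)))
                    (λ u e' → let e = trans e' (proj₂ q) in
                      trans (cong cp (trans (same₂ u (λ e'' → c≢b' (trans (sym e'') e)) (λ { refl → b≢b' e }))
                        (same₁ u (λ e'' → b≢b' (trans (sym e'') e)) (λ { refl → out g∈ b'≢i b'≢a e }))))
                        (trans (pres b' b'≢i b'≢a u e) (sym (proj₂ q))))
          where
          -- The hole now leads into tgt h, which is fault-free because h is free.
          free₂ : Free (c , proj₁ q)
          free₂ e (inj₁ (inj₁ x)) = proj₁ (un e) (cong (λ q → cp (proj₁ q)) x)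
          free₂ e (inj₁ (inj₂ x)) = proj₂ (un e) (cong (λ q → cp (proj₂ q)) x)
          free₂ e (inj₂ x) = fh e (inj₂ (subst (λ b → Ins b e) (proj₂ q) x))

-- Search and counting over the colours

abstract
  find-or : ∀ {n} {P Q : Fin n → Set} → (∀ c → P c ⊎ Q c) → ∃ P ⊎ (∀ c → Q c)
  find-or {zero} f = inj₂ λ ()
  find-or {suc n} f with f zero | find-or (λ c → f (suc c))
  ... | inj₁ p | _ = inj₁ (zero , p)
  ... | inj₂ q | inj₁ (c , p) = inj₁ (suc c , p)
  ... | inj₂ q | inj₂ r = inj₂ λ { zero → q ; (suc c) → r c }

abstract
  find-or-but : ∀ {n} (l : Fin n) {P Q : Fin n → Set} → (∀ c → P c ⊎ Q c) →
                (∃ λ c → c ≢ l × P c) ⊎ (∀ c → c ≢ l → Q c)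
  find-or-but l {P} {Q} f = find-or dec
    where
    dec : ∀ c → (c ≢ l × P c) ⊎ (c ≢ l → Q c)
    dec c with c ≟ l | f c
    ... | yes p | _ = inj₂ (λ q → ⊥-elim (q p))
    ... | no p | inj₁ q = inj₁ (p , q)
    ... | no _ | inj₂ q = inj₂ (λ _ → q)

abstract
  choose-but : ∀ {N n} (l : Fin (suc n)) {S : Fin (suc n) → Fin N → Set} → (∀ c → c ≢ l → ∃ (S c)) →
               (∀ {c d e} → S c e → S d e → c ≡ d) → Distinct n (λ e → ∃ λ c → c ≢ l × S c e)
  choose-but {n = n} l {S} w apart = distinct (Distinct.f F) (Distinct.inj F) λ a →
    let (c , s) = Distinct.sat F a in punchIn l c , punchInᵢ≢i l c , s
    where
    F : Distinct n (λ e → ∃ λ c → S (punchIn l c) e)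
    F = choose (λ c → w (punchIn l c) (punchInᵢ≢i l c)) (λ {c} {d} p q → punchIn-injective l c d (apart p q))

abstract
  two-others : ∀ {k} → 2 ≤ k → (l : Fin (suc k)) → ∃ λ c → ∃ λ d → c ≢ l × d ≢ l × c ≢ d
  two-others (s≤s (s≤s z≤n)) l = punchIn l zero , punchIn l (suc zero) , punchInᵢ≢i l zero , punchInᵢ≢i l (suc zero) ,
    λ p → 0≢1 (punchIn-injective l zero (suc zero) p)
    where
    0≢1 : ∀ {n} → _≢_ {A = Fin (suc (suc n))} zero (suc zero)
    0≢1 ()

-- Faults in D_{k+1,2}

module Step {T k : ℕ} (2≤k : 2 ≤ k) (H : Coloured (Fin T) (suc k)) (bc : Bicritical H)
            (F : List (Cross.P T × Cross.P T)) where
  open Faulty H bc F public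

  InC : Fin (suc T) → Fin (suc k) → Fault → Set
  InC b c e = ∃ λ w → By (b , w) (suc c) e

  abstract
    inC? : ∀ b c e → Dec (InC b c e)
    inC? b c e = any? λ w → by? (b , w) (suc c) e

  InC-Ins : ∀ {b c e} → InC b c e → Ins b e
  InC-Ins {b} {c} (w , p) = By-Ins {b} {w} {c} p

  InC-uniq : ∀ {b c d e} → InC b c e → InC b d e → c ≡ d
  InC-uniq {b} {c} {d} (w , p) (w' , q) = suc-injective (proj₁ (By-uniq {b , w} {suc c} {b , w'} {suc d} p q))

  by-uniq : ∀ {b w w' c d e} → By (b , w) (suc c) e → By (b , w') (suc d) e → c ≡ d × (w ≡ w' ⊎ H.ν c w ≡ w')
  by-uniq {b} {w} {w'} {c} {d} p q with By-uniq {b , w} {suc c} {b , w'} {suc d} p q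
  ... | x , inj₁ y = suc-injective x , inj₁ (cong proj₂ y)
  ... | x , inj₂ y = suc-injective x , inj₂ (cong proj₂ y)

  by-kill : ∀ {b w w' c e} → By (b , w) (suc c) e → ¬ Kill (b , w') e
  by-kill {b} {w} {w'} {c} p q = Kill≢Ins {b , w'} q (By-Ins {b} {w} {c} p)

  kill-uniq : ∀ {b w w' e} → Kill (b , w) e → Kill (b , w') e → w ≡ w'
  kill-uniq {b} {w} {w'} p q = cong proj₂ (Kill-uniq {b , w} {b , w'} refl p q)

  Unhit : Fin (suc T) → Fin (suc k) → Set
  Unhit b c = ∀ e → ¬ InC b c e

  dec-hit : ∀ b c → Unhit b c ⊎ ∃ (InC b c)
  dec-hit b c with any? (inC? b c)
  ... | yes p = inj₂ p
  ... | no p = inj₁ (λ e q → p (e , q))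

  dec-edge : ∀ u c → ¬ Hit u c ⊎ Hit u c
  dec-edge u c with hit? u c
  ... | yes p = inj₂ p
  ... | no p = inj₁ p

  module Overfull (room : length F + (length F + 4) < suc T) (few : length F ≤ suc k + suc k) where
    open Routing room public

    over : ∀ {n} {Q : Fault → Set} → Distinct n Q → suc (suc k + suc k) ≤ n → ⊥
    over fm p = ℕ.<-irrefl refl (ℕ.≤-trans p (ℕ.≤-trans (bound fm) few))

    2+2k : suc k + suc k ≡ 2 + (k + k)
    2+2k = cong suc (ℕ.+-suc k k)

    -- The holes at the two ends of the only fault of colour `l` in copy `i`

    module Copy (i : Fin (suc T)) (l : Fin (suc k))
                (e₀ : Fault) (u₀ : P) (cross₀ : By u₀ zero e₀)
                (κ : Fin (suc T) → Fin (suc k)) (κ-i : κ i ≡ l) (κ-o : ∀ b → b ≢ i → Unhit b (κ b))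
                (noiso : ∀ u → ∃ λ c → ¬ Hit u c)
                (x : Fin T) (hit-l : Hit (i , x) (suc l))
                (single-l : ∀ w → Hit (i , w) (suc l) → w ≡ x ⊎ w ≡ H.ν l x) where

      y : Fin T
      y = H.ν l x

      X Y : P
      X = i , x
      Y = i , y

      -- The landing vertex of a hole at `w` that slides along colour `c`, as copy `i` is matched by
      -- colour `l`.
      α : Fin (suc k) → Fin T → Fin T
      α c w = H.ν l (H.ν c w)

      -- The two ways in which a fault stops the slide from `w` along `c`. The clause `¬ Hit` is
      -- kept because `deeper` must know that a killed landing vertex of `x` was counted only behind
      -- a good edge.
      S : Fin T → Fin (suc k) → Fault → Set
      S w c e = By (i , w) (suc c) e ⊎ (¬ Hit (i , w) (suc c) × Kill (i , α c w) e)

      -- A hole at w gets out of copy i after at most one slide.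
      Exit : Fin T → Set
      Exit w = Free (i , w) ⊎ (∃ λ c → c ≢ l × (¬ Hit (i , w) (suc c) × Free (i , α c w)))

      Blocked : Fin T → Set
      Blocked w = ∃ (Kill (i , w)) × (∀ c → c ≢ l → ∃ (S w c))

      abstract
        explore : ∀ w → (∃ λ c → c ≢ l × (¬ Hit (i , w) (suc c) × Free (i , α c w))) ⊎ (∀ c → c ≢ l → ∃ (S w c))
        explore w = find-or-but l dec
          where
          dec : ∀ c → (¬ Hit (i , w) (suc c) × Free (i , α c w)) ⊎ ∃ (S w c)
          dec c with dec-edge (i , w) (suc c) | free? (i , α c w)
          ... | inj₂ (e , p) | _ = inj₂ (e , inj₁ p)
          ... | inj₁ p | inj₁ q = inj₁ (p , q)
          ... | inj₁ p | inj₂ (e , q) = inj₂ (e , inj₂ (p , q))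

      abstract
        exit? : ∀ w → Exit w ⊎ Blocked w
        exit? w with free? (i , w) | explore w
        ... | inj₁ p | _ = inj₁ (inj₁ p)
        ... | inj₂ _ | inj₁ q = inj₁ (inj₂ q)
        ... | inj₂ p | inj₂ q = inj₂ (p , q)

      ν-flip : ∀ {c a b} → H.ν c a ≡ b → a ≡ H.ν c b
      ν-flip {c} {a} p = trans (sym (H.ν-inv c a)) (cong (H.ν c) p)

      α-irr : ∀ {c w} → c ≢ l → α c w ≢ w
      α-irr p q = p (H.ν-col (ν-flip q))

      α-inj : ∀ {c d w} → α c w ≡ α d w → c ≡ d
      α-inj p = H.ν-col (H.ν-inj p)

      S-uniq : ∀ {w c d e} → S w c e → S w d e → c ≡ d
      S-uniq {w} {c} {d} (inj₁ p) (inj₁ q) = proj₁ (by-uniq {i} {w} {w} {c} {d} p q)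
      S-uniq {w} {c} {d} (inj₁ p) (inj₂ (_ , q)) = ⊥-elim (by-kill {i} {w} {α d w} {c} p q)
      S-uniq {w} {c} {d} (inj₂ (_ , p)) (inj₁ q) = ⊥-elim (by-kill {i} {w} {α c w} {d} q p)
      S-uniq {w} {c} {d} (inj₂ (_ , p)) (inj₂ (_ , q)) = α-inj {c} {d} {w} (kill-uniq {i} {α c w} {α d w} p q)

      -- The faults blocking x, those blocking y, and the fault xy are 2k + 3 distinct faults.
      abstract
        not-both : Blocked x → Blocked y → ⊥
        not-both ((ex , kx) , sx) ((ey , ky) , sy) =
          over (single (proj₁ hit-l) (proj₂ hit-l) ⊕[ d₁ ] single ex kx ⊕[ d₂ ] single ey ky ⊕[ d₃ ]
                choose-but l sx (S-uniq {x}) ⊕[ d₄ ] choose-but l sy (S-uniq {y}))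
               (ℕ.≤-reflexive (cong suc 2+2k))
          where
          SX SY : Fault → Set
          SX e = ∃ λ c → c ≢ l × S x c e
          SY e = ∃ λ c → c ≢ l × S y c e
          x≢y : x ≢ y
          x≢y p = H.ν-irr l x (sym p)
          d₁ : ∀ {e} → By X (suc l) e → Kill X e ⊎ Kill Y e ⊎ SX e ⊎ SY e → ⊥
          d₁ p (inj₁ q) = by-kill {i} {x} {x} {l} p q
          d₁ p (inj₂ (inj₁ q)) = by-kill {i} {x} {y} {l} p q
          d₁ p (inj₂ (inj₂ (inj₁ (c , c≢l , inj₁ q)))) = c≢l (sym (proj₁ (by-uniq {i} {x} {x} {l} {c} p q)))
          d₁ p (inj₂ (inj₂ (inj₁ (c , c≢l , inj₂ (_ , q))))) = by-kill {i} {x} {α c x} {l} p q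
          d₁ p (inj₂ (inj₂ (inj₂ (c , c≢l , inj₁ q)))) = c≢l (sym (proj₁ (by-uniq {i} {x} {y} {l} {c} p q)))
          d₁ p (inj₂ (inj₂ (inj₂ (c , c≢l , inj₂ (_ , q))))) = by-kill {i} {x} {α c y} {l} p q
          d₂ : ∀ {e} → Kill X e → Kill Y e ⊎ SX e ⊎ SY e → ⊥
          d₂ p (inj₁ q) = x≢y (kill-uniq {i} {x} {y} p q)
          d₂ p (inj₂ (inj₁ (c , c≢l , inj₁ q))) = by-kill {i} {x} {x} {c} q p
          d₂ p (inj₂ (inj₁ (c , c≢l , inj₂ (_ , q)))) = α-irr {c} {x} c≢l (kill-uniq {i} {α c x} {x} q p)
          d₂ p (inj₂ (inj₂ (c , c≢l , inj₁ q))) = by-kill {i} {y} {x} {c} q p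
          d₂ p (inj₂ (inj₂ (c , c≢l , inj₂ (_ , q)))) = H.ν-irr c y (ν-flip (kill-uniq {i} {α c y} {x} q p))
          d₃ : ∀ {e} → Kill Y e → SX e ⊎ SY e → ⊥
          d₃ p (inj₁ (c , c≢l , inj₁ q)) = by-kill {i} {x} {y} {c} q p
          d₃ p (inj₁ (c , c≢l , inj₂ (_ , q))) = H.ν-irr c x (H.ν-inj (kill-uniq {i} {α c x} {y} q p))
          d₃ p (inj₂ (c , c≢l , inj₁ q)) = by-kill {i} {y} {y} {c} q p
          d₃ p (inj₂ (c , c≢l , inj₂ (_ , q))) = α-irr {c} {y} c≢l (kill-uniq {i} {α c y} {y} q p)
          d₄ : ∀ {e} → SX e → SY e → ⊥
          d₄ (c , c≢l , inj₁ p) (d , d≢l , inj₁ q) with by-uniq {i} {x} {y} {c} {d} p q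
          ... | refl , inj₁ r = x≢y r
          ... | refl , inj₂ r = c≢l (H.ν-col r)
          d₄ (c , _ , inj₁ p) (d , _ , inj₂ (_ , q)) = by-kill {i} {x} {α d y} {c} p q
          d₄ (c , _ , inj₂ (_ , p)) (d , _ , inj₁ q) = by-kill {i} {y} {α c x} {d} q p
          d₄ (c , _ , inj₂ (_ , p)) (d , _ , inj₂ (_ , q)) =
            H.no3 (H.edge c x) (subst (λ z → H.E z y) (sym (H.ν-inj (kill-uniq {i} {α c x} {α d y} p q))) (H.edge⁻ d y))
                  (H.edge⁻ l x)

      -- The choice of colours is a parameter again, because in `Stuck` the hole enters another copy
      -- and that copy's colour is then chosen to suit it.
      module Base (κ : Fin (suc T) → Fin (suc k)) (κ-i : κ i ≡ l) (κ-o : ∀ b → b ≢ i → Unhit b (κ b)) where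
        M : P → P
        M u = cp u , H.ν (κ (cp u)) (proj₂ u)

        abstract
          cut-state : Σ (NearPerfect Good X Y) λ s → ∀ u → u ≢ X → u ≢ Y → NearPerfect.m s u ≡ M u
          cut-state = cut M X Y (λ p → H.ν-irr l x (sym (cong proj₂ p))) (cong (λ c → i , H.ν c x) κ-i)
            (λ u → cong (cp u ,_) (H.ν-inv (κ (cp u)) (proj₂ u))) good
            where
            good : ∀ u → u ≢ X → u ≢ Y → Good u (M u)
            good (b , w) p q with b ≟ i
            ... | no b≢i = suc (κ b) , refl , λ { (e , r) → κ-o b b≢i e (w , r) }
            ... | yes refl rewrite κ-i = suc l , refl , λ r → [ (λ { refl → p refl }) , (λ { refl → q refl }) ]′ (single-l w r)

        s₀ : NearPerfect Good X Y
        s₀ = proj₁ cut-state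

        s₀-in : ∀ {w} → w ≢ x → w ≢ y → NearPerfect.m s₀ (i , w) ≡ (i , H.ν l w)
        s₀-in {w} p q = trans (proj₂ cut-state (i , w) (λ { refl → p refl }) (λ { refl → q refl }))
                          (cong (λ c → i , H.ν c w) κ-i)

        s₀-out : ∀ {b w} → b ≢ i → NearPerfect.m s₀ (b , w) ≡ (b , H.ν (κ b) w)
        s₀-out {b} {w} p = proj₂ cut-state (b , w) (λ { refl → p refl }) (λ { refl → p refl })

        pres₀ : ∀ b → b ≢ i → Pres s₀ b
        pres₀ b p (.b , w) refl = cong cp (s₀-out p)

      good-in : ∀ {b w c} → ¬ Hit (b , w) (suc c) → Good (b , w) (b , H.ν c w)
      good-in {c = c} p = suc c , refl , p

      abstract
        slide-in : ∀ {w h} (s : NearPerfect Good (i , w) h) c → NearPerfect.m s (i , H.ν c w) ≡ (i , α c w) →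
                   ¬ Hit (i , w) (suc c) → (i , H.ν c w) ≢ h →
                   Σ (NearPerfect Good (i , α c w) h) λ s' →
                     (∀ v → v ≢ w → v ≢ H.ν c w → v ≢ α c w → NearPerfect.m s' (i , v) ≡ NearPerfect.m s (i , v)) ×
                     (∀ u → cp u ≢ i → NearPerfect.m s' u ≡ NearPerfect.m s u)
        slide-in {w} s c mz p z≢h with slide s (i , H.ν c w) (i , α c w) mz (good-in p) z≢h
        ... | s' , same = s' , (λ v a b d → same (i , v) (λ { refl → a refl }) (λ { refl → b refl }) (λ { refl → d refl }))
                        , (λ u u∉i → same u (λ { refl → u∉i refl }) (λ { refl → u∉i refl }) (λ { refl → u∉i refl }))

      abstract
        -- The hole at `y` now uses its exit. Either the matching around `ν c y` is still the
        -- original one, or the first hole stands there, and then the two holes are adjacent and are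
        -- joined. `away` keeps the second hole from leading into `a`, where the matching need not
        -- be preserved.
        finish : ∀ {g} (s : NearPerfect Good g Y) a → (cp g ≡ i ⊎ cp g ≡ a) → Free g → tgt g ≢ i → tgt g ≢ a →
                 (∀ b → b ≢ i → b ≢ a → Pres s b) → (∀ w → Free (i , w) → tgt (i , w) ≢ a) →
                 Exit y → (∀ c → c ≢ l → (i , H.ν c y) ≡ g ⊎ NearPerfect.m s (i , H.ν c y) ≡ (i , α c y)) → Perfect Good
        finish s a g∈ fg p q pres away (inj₁ fy) _ =
          endgame s i a g∈ (inj₁ refl) fg fy p q (tgt≢ Y) (away y fy) pres
        finish {g} s a g∈ fg p q pres away (inj₂ (c , c≢l , ok , fy)) route with (i , H.ν c y) ≟P g
        ... | yes eq = join-holes s (Good-sym (subst (Good Y) eq (good-in ok)))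
        ... | no neq with route c c≢l
        ...   | inj₁ eq = ⊥-elim (neq eq)
        ...   | inj₂ eq with slide-in (exchange s) c eq ok neq
        ...     | s' , _ , keep = endgame (exchange s') i a g∈ (inj₁ refl) fg fy p q
                   (tgt≢ (i , α c y)) (away (α c y) fy) (λ { b b≢i b≢a u refl → trans (cong cp (keep u b≢i)) (pres b b≢i b≢a u refl) })

      yx : H.E y x
      yx = l , H.ν-inv l x

      flip-y : ∀ {c w} → α c w ≡ y → H.ν c w ≡ x
      flip-y p = H.ν-inj p

      flip-x : ∀ {c w} → α c w ≡ x → H.ν c w ≡ y
      flip-x p = ν-flip p

      y'≢x : ∀ {c} → c ≢ l → H.ν c y ≢ x
      y'≢x c≢l p = c≢l (H.ν-col (trans p (sym (H.ν-inv l x))))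

      -- Moving the hole at `x` when `y` has an exit

      module Found (ey : Exit y) where
        open Base κ κ-i κ-o

        -- x — p — z with the first edge good of colour c₁ and the second of colour l.
        module Out (c₁ : Fin (suc k)) (c₁≢l : c₁ ≢ l) where
          p z : Fin T
          p = H.ν c₁ x
          z = α c₁ x

          xp : H.E x p
          xp = H.edge c₁ x

          pz : H.E p z
          pz = H.edge l p

          z≢x : z ≢ x
          z≢x = α-irr c₁≢l

          p≢y : p ≢ y
          p≢y q = c₁≢l (H.ν-col q)

          νz≢x : ∀ {c} → H.ν c z ≢ x
          νz≢x {c} q = H.no3 xp pz (c , q)

          νz≢y : ∀ {c} → H.ν c z ≢ y
          νz≢y {c} q = H.no4 xp pz (c , q) yx (λ e → z≢x (sym e)) p≢y

          νz≢p : ∀ {c} → c ≢ l → H.ν c z ≢ p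
          νz≢p c≢l q = c≢l (H.ν-col (trans q (sym (H.ν-inv l p))))

          y'≢p : ∀ {c} → H.ν c y ≢ p
          y'≢p {c} q = H.no3 xp (H.E-sym (c , q)) yx

          y'≢z : ∀ {c} → H.ν c y ≢ z
          y'≢z {c} q = νz≢y (trans (cong (H.ν c) (sym q)) (H.ν-inv c y))

          abstract
            first : ¬ Hit X (suc c₁) →
                    Σ (NearPerfect Good (i , z) Y) λ s₁ →
                      (∀ v → v ≢ x → v ≢ p → v ≢ z → v ≢ y → NearPerfect.m s₁ (i , v) ≡ (i , H.ν l v)) ×
                      (∀ u → cp u ≢ i → NearPerfect.m s₁ u ≡ NearPerfect.m s₀ u)
            first ok with slide-in s₀ c₁ (s₀-in (H.ν-irr c₁ x) p≢y) ok (λ q → p≢y (cong proj₂ q))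
            ... | s₁ , same , out = s₁ , (λ v a b d e → trans (same v a b d) (s₀-in a e)) , out

          abstract
            second : ¬ Hit X (suc c₁) → ∀ c → c ≢ l → ¬ Hit (i , z) (suc c) →
                     Σ (NearPerfect Good (i , α c z) Y) λ s₂ →
                       (∀ v → v ≢ x → v ≢ p → v ≢ z → v ≢ y → v ≢ H.ν c z → v ≢ α c z →
                         NearPerfect.m s₂ (i , v) ≡ (i , H.ν l v)) ×
                       (∀ u → cp u ≢ i → NearPerfect.m s₂ u ≡ NearPerfect.m s₀ u)
            second ok c c≢l ok' with first ok
            ... | s₁ , same₁ , out₁ with slide-in s₁ c (same₁ (H.ν c z) νz≢x (νz≢p c≢l) (H.ν-irr c z) νz≢y) ok'
                                                (λ q → νz≢y (cong proj₂ q))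
            ...   | s₂ , same₂ , out₂ = s₂ , (λ v a b d e f g → trans (same₂ v d f g) (same₁ v a b d e))
                                      , (λ u u∉ → trans (out₂ u u∉) (out₁ u u∉))

        pres-of : ∀ {g h} (s : NearPerfect Good g h) → (∀ u → cp u ≢ i → NearPerfect.m s u ≡ NearPerfect.m s₀ u) →
                  ∀ b → b ≢ i → Pres s b
        pres-of s out b b≢i u refl = trans (cong cp (out u b≢i)) (pres₀ b b≢i u refl)

        abstract
          finish-in : ∀ {w} (s : NearPerfect Good (i , w) Y) → Free (i , w) →
                      (∀ u → cp u ≢ i → NearPerfect.m s u ≡ NearPerfect.m s₀ u) → Exit y →
                      (∀ c → c ≢ l → (i , H.ν c y) ≡ (i , w) ⊎ NearPerfect.m s (i , H.ν c y) ≡ (i , α c y)) → Perfect Good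
          finish-in {w} s fw out ey route = finish s i (inj₁ refl) fw (tgt≢ (i , w)) (tgt≢ (i , w))
            (λ b b≢i _ → pres-of s out b b≢i) (λ w _ → tgt≢ (i , w)) ey route

        abstract
          finish-free : ∀ {w} (s : NearPerfect Good (i , w) Y) → Free (i , w) → Free Y →
                        (∀ u → cp u ≢ i → NearPerfect.m s u ≡ NearPerfect.m s₀ u) → Perfect Good
          finish-free {w} s fw fy out = endgame s i i (inj₁ refl) (inj₁ refl) fw fy (tgt≢ (i , w)) (tgt≢ (i , w))
            (tgt≢ Y) (tgt≢ Y) (λ b b≢i _ → pres-of s out b b≢i)

        abstract
          depth₀ : Free X → Perfect Good
          depth₀ fx = finish-in s₀ fx (λ _ _ → refl) ey (λ c c≢l → inj₂ (s₀-in (y'≢x c≢l) (H.ν-irr c y)))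

        abstract
          depth₁ : ∀ c₁ → c₁ ≢ l → ¬ Hit X (suc c₁) → Free (i , α c₁ x) → Perfect Good
          depth₁ c₁ c₁≢l ok fz with Out.first c₁ c₁≢l ok
          ... | s₁ , same , out = finish-in s₁ fz out ey route
            where
            open Out c₁ c₁≢l
            route : ∀ c → c ≢ l → (i , H.ν c y) ≡ (i , z) ⊎ NearPerfect.m s₁ (i , H.ν c y) ≡ (i , α c y)
            route c c≢l = inj₂ (same (H.ν c y) (y'≢x c≢l) y'≢p y'≢z (H.ν-irr c y))

        abstract
          -- After two slides the hole may stand next to `y`: this is the first alternative of
          -- `route`. A neighbour of `y` cannot be passed on the second slide, since it would close
          -- a 5-cycle with `x`, `p` and `z`.
          depth₂ : ∀ c₁ → c₁ ≢ l → ¬ Hit X (suc c₁) → ∀ c → c ≢ l → ¬ Hit (i , α c₁ x) (suc c) →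
                   Free (i , α c (α c₁ x)) → Perfect Good
          depth₂ c₁ c₁≢l ok d d≢l ok' fz with Out.second c₁ c₁≢l ok d d≢l ok'
          ... | s₂ , same , out = finish-in s₂ fz out ey route
            where
            open Out c₁ c₁≢l
            route : ∀ c → c ≢ l → (i , H.ν c y) ≡ (i , α d z) ⊎ NearPerfect.m s₂ (i , H.ν c y) ≡ (i , α c y)
            route c c≢l with H.ν c y ≟ α d z
            ... | yes q = inj₁ (cong (i ,_) q)
            ... | no q = inj₂ (same (H.ν c y) (y'≢x c≢l) y'≢p y'≢z (H.ν-irr c y)
                   (λ r → H.no5 xp pz (d , sym r) (H.edge⁻ c y) yx) q)

        module Tight (c₁ : Fin (suc k)) (c₁≢l : c₁ ≢ l) (ok : ¬ Hit X (suc c₁)) (kx : ∃ (Kill X))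
                     (sx : ∀ c → c ≢ l → ∃ (S x c)) (sz : ∀ c → c ≢ l → ∃ (S (α c₁ x) c)) where
          open Out c₁ c₁≢l

          Z : P
          Z = i , z

          SX SZ : Fault → Set
          SX e = ∃ λ c → c ≢ l × S x c e
          SZ e = ∃ λ c → c ≢ l × S z c e

          abstract
            -- The edge between `x` and `y`, one fault that kills `X`, `k` that stop the slides from
            -- `x` and `k` that stop those from `z` make 2k + 2. A coincidence of landing vertices
            -- of `x` and `z` would close a 4-cycle through `p`.
            all-faults : ∀ e → By X (suc l) e ⊎ Kill X e ⊎ SX e ⊎ SZ e
            all-faults = exhaust (single (proj₁ hit-l) (proj₂ hit-l) ⊕[ d₁ ] single (proj₁ kx) (proj₂ kx) ⊕[ d₂ ]
              choose-but l sx (S-uniq {x}) ⊕[ d₃ ] choose-but l sz (S-uniq {z}))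
              (subst (length F ≤_) 2+2k few)
              where
              d₁ : ∀ {e} → By X (suc l) e → Kill X e ⊎ SX e ⊎ SZ e → ⊥
              d₁ p (inj₁ q) = by-kill {i} {x} {x} {l} p q
              d₁ p (inj₂ (inj₁ (c , c≢l , inj₁ q))) = c≢l (sym (proj₁ (by-uniq {i} {x} {x} {l} {c} p q)))
              d₁ p (inj₂ (inj₁ (c , c≢l , inj₂ (_ , q)))) = by-kill {i} {x} {α c x} {l} p q
              d₁ p (inj₂ (inj₂ (c , c≢l , inj₁ q))) = c≢l (sym (proj₁ (by-uniq {i} {x} {z} {l} {c} p q)))
              d₁ p (inj₂ (inj₂ (c , c≢l , inj₂ (_ , q)))) = by-kill {i} {x} {α c z} {l} p q
              d₂ : ∀ {e} → Kill X e → SX e ⊎ SZ e → ⊥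
              d₂ p (inj₁ (c , c≢l , inj₁ q)) = by-kill {i} {x} {x} {c} q p
              d₂ p (inj₁ (c , c≢l , inj₂ (_ , q))) = α-irr {c} {x} c≢l (kill-uniq {i} {α c x} {x} q p)
              d₂ p (inj₂ (c , c≢l , inj₁ q)) = by-kill {i} {z} {x} {c} q p
              d₂ p (inj₂ (c , c≢l , inj₂ (_ , q))) = νz≢y {c} (flip-x {c} (kill-uniq {i} {α c z} {x} q p))
              d₃ : ∀ {e} → SX e → SZ e → ⊥
              d₃ (c , c≢l , inj₁ q) (d , d≢l , inj₁ r) with by-uniq {i} {x} {z} {c} {d} q r
              ... | _ , inj₁ t = z≢x (sym t)
              ... | _ , inj₂ t = H.no3 xp pz (H.E-sym (c , t))
              d₃ (c , c≢l , inj₁ q) (d , d≢l , inj₂ (_ , r)) = by-kill {i} {x} {α d z} {c} q r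
              d₃ (c , c≢l , inj₂ (_ , q)) (d , d≢l , inj₁ r) = by-kill {i} {z} {α c x} {d} r q
              d₃ (c , c≢l , inj₂ (_ , q)) (d , d≢l , inj₂ (_ , r)) =
                H.no4 xp pz (d , sym (H.ν-inj (kill-uniq {i} {α c x} {α d z} q r))) (H.edge⁻ c x)
                  (λ t → z≢x (sym t))
                  (λ t → νz≢p d≢l (trans (sym (H.ν-inj (kill-uniq {i} {α c x} {α d z} q r))) (sym t)))

          kills-in : ∀ w {e} → Kill (i , w) e → w ≡ x ⊎ (∃ λ c → ¬ Hit X (suc c) × c ≢ l × w ≡ α c x) ⊎
                     (∃ λ c → w ≡ α c z)
          kills-in w {e} q with all-faults e
          ... | inj₁ r = ⊥-elim (by-kill {i} {x} {w} {l} r q)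
          ... | inj₂ (inj₁ r) = inj₁ (kill-uniq {i} {w} {x} q r)
          ... | inj₂ (inj₂ (inj₁ (c , _ , inj₁ r))) = ⊥-elim (by-kill {i} {x} {w} {c} r q)
          ... | inj₂ (inj₂ (inj₁ (c , c≢l , inj₂ (n , r)))) = inj₂ (inj₁ (c , n , c≢l , kill-uniq {i} {w} {α c x} q r))
          ... | inj₂ (inj₂ (inj₂ (c , _ , inj₁ r))) = ⊥-elim (by-kill {i} {z} {w} {c} r q)
          ... | inj₂ (inj₂ (inj₂ (c , _ , inj₂ (_ , r)))) = inj₂ (inj₂ (c , kill-uniq {i} {w} {α c z} q r))

          edges-in : ∀ w d → d ≢ l → Hit (i , w) (suc d) → (w ≡ x ⊎ H.ν d w ≡ x) ⊎ (w ≡ z ⊎ H.ν d w ≡ z)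
          edges-in w d d≢l (e , q) with all-faults e
          ... | inj₁ r = ⊥-elim (d≢l (proj₁ (by-uniq {i} {w} {x} {d} {l} q r)))
          ... | inj₂ (inj₁ r) = ⊥-elim (by-kill {i} {w} {x} {d} q r)
          ... | inj₂ (inj₂ (inj₁ (c , _ , inj₁ r))) = inj₁ (proj₂ (by-uniq {i} {w} {x} {d} {c} q r))
          ... | inj₂ (inj₂ (inj₁ (c , _ , inj₂ (_ , r)))) = ⊥-elim (by-kill {i} {w} {α c x} {d} q r)
          ... | inj₂ (inj₂ (inj₂ (c , _ , inj₁ r))) = inj₂ (proj₂ (by-uniq {i} {w} {z} {d} {c} q r))
          ... | inj₂ (inj₂ (inj₂ (c , _ , inj₂ (_ , r)))) = ⊥-elim (by-kill {i} {w} {α c z} {d} q r)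

          abstract
            free-y : Free Y
            free-y e q with kills-in y q
            ... | inj₁ r = H.ν-irr l x r
            ... | inj₂ (inj₁ (c , _ , _ , r)) = H.ν-irr c x (H.ν-inj (sym r))
            ... | inj₂ (inj₂ (c , r)) = νz≢x {c} (flip-y {c} (sym r))

          -- A second good edge at x: z and z₂ have at most one common neighbour, so one of two exits is free.
          abstract
            branch : ∀ c₂ → c₂ ≢ l → c₂ ≢ c₁ → ¬ Hit X (suc c₂) → Perfect Good
            branch c₂ c₂≢l c₂≢c₁ ok₂ = go (two-others 2≤k l)
              where
              module O = Out c₂ c₂≢l
              z₂ : Fin T
              z₂ = O.z
              clean : ∀ d → d ≢ l → ¬ Hit (i , z₂) (suc d)
              clean d d≢l h with edges-in z₂ d d≢l h
              ... | inj₁ (inj₁ q) = O.z≢x q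
              ... | inj₁ (inj₂ q) = O.νz≢x q
              ... | inj₂ (inj₁ q) = c₂≢c₁ (α-inj q)
              ... | inj₂ (inj₂ q) = H.no5 xp pz (H.E-sym (d , q)) (H.E-sym O.pz) (H.E-sym O.xp)
              common : ∀ d → d ≢ l → ∀ {e} → Kill (i , α d z₂) e → ∃ λ c → H.ν d z₂ ≡ H.ν c z
              common d d≢l q with kills-in (α d z₂) q
              ... | inj₁ r = ⊥-elim (O.νz≢y (flip-x {d} r))
              ... | inj₂ (inj₁ (c , _ , _ , r)) = ⊥-elim (H.no4 O.xp O.pz (d , H.ν-inj r) (H.edge⁻ c x)
                      (λ t → O.z≢x (sym t)) (λ t → O.νz≢p d≢l (trans (H.ν-inj r) (sym t))))
              ... | inj₂ (inj₂ (c , r)) = c , H.ν-inj r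
              leave : ∀ d → d ≢ l → Free (i , α d z₂) → Perfect Good
              leave d d≢l f with O.second ok₂ d d≢l (clean d d≢l)
              ... | s₂ , _ , out = finish-free s₂ f free-y out
              go : (∃ λ c → ∃ λ d → c ≢ l × d ≢ l × c ≢ d) → Perfect Good
              go (c , d , c≢l , d≢l , c≢d) with free? (i , α c z₂) | free? (i , α d z₂)
              ... | inj₁ f | _ = leave c c≢l f
              ... | inj₂ _ | inj₁ f = leave d d≢l f
              ... | inj₂ (_ , q) | inj₂ (_ , r) with common c c≢l q | common d d≢l r
              ...   | c' , t | d' , t' = ⊥-elim (H.no4 (H.edge c z₂) (H.E-sym (c' , sym t)) (d' , sym t') (H.edge⁻ d z₂)
                        (λ u → c₂≢c₁ (α-inj u)) (λ u → c≢d (H.ν-col u)))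

          abstract
            -- A third slide succeeds. By `edges-in` every colour other than `l` is good at `w`. A
            -- kill of `α d w` would be one of those counted at `x` or at `z`; as `c₁` is the only
            -- good colour at `x`, this forces a 4-cycle, or `ν d w` is `y` and the holes are
            -- already adjacent.
            deeper : (∀ c → c ≢ l → c ≡ c₁ ⊎ Hit X (suc c)) → ∀ c → c ≢ l → ¬ Hit Z (suc c) → Perfect Good
            deeper only c c≢l ok' = go (two-others 2≤k l)
              where
              q w : Fin T
              q = H.ν c z
              w = α c z
              zq : H.E z q
              zq = H.edge c z
              qw : H.E q w
              qw = H.edge l q
              w≢z : w ≢ z
              w≢z = α-irr c≢l
              w'≢x : ∀ {d} → H.ν d w ≢ x
              w'≢x {d} r = H.no5 xp pz zq qw (d , r)
              w'≢z : ∀ {d} → H.ν d w ≢ z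
              w'≢z {d} r = H.no3 zq qw (d , r)
              w'≢q : ∀ {d} → d ≢ l → H.ν d w ≢ q
              w'≢q d≢l r = d≢l (H.ν-col (trans r (sym (H.ν-inv l q))))
              w'≢p : ∀ {d} → H.ν d w ≢ p
              w'≢p {d} r = H.no4 pz zq qw (d , r) (λ t → νz≢p c≢l (sym t)) (λ t → w≢z (sym t))
              clean : ∀ d → d ≢ l → ¬ Hit (i , w) (suc d)
              clean d d≢l h with edges-in w d d≢l h
              ... | inj₁ (inj₁ r) = νz≢y (flip-x {c} r)
              ... | inj₁ (inj₂ r) = w'≢x r
              ... | inj₂ (inj₁ r) = w≢z r
              ... | inj₂ (inj₂ r) = w'≢z r
              free : ∀ d → d ≢ l → H.ν d w ≢ y → Free (i , α d w)
              free d d≢l w'≢y e r with kills-in (α d w) r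
              ... | inj₁ t = w'≢y (flip-x {d} t)
              ... | inj₂ (inj₁ (c' , n , c'≢l , t)) = [ (λ { refl → w'≢p (H.ν-inj t) }) , n ]′ (only c' c'≢l)
              ... | inj₂ (inj₂ (c' , t)) = H.no4 zq qw (d , H.ν-inj t) (H.edge⁻ c' z)
                (λ u → w≢z (sym u)) (λ u → w'≢q d≢l (trans (H.ν-inj t) (sym u)))
              go : (∃ λ c → ∃ λ d → c ≢ l × d ≢ l × c ≢ d) → Perfect Good
              go (d , _ , d≢l , _) with H.ν d w ≟ y
              ... | yes r =
                let (s₂ , _) = second ok c c≢l ok'
                in join-holes s₂ (subst (Good (i , w)) (cong (i ,_) r) (good-in (clean d d≢l)))
              ... | no w'≢y =
                let (s₂ , same , out) = second ok c c≢l ok'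
                    (s₃ , _ , out₃) = slide-in s₂ d (same (H.ν d w) w'≢x w'≢p w'≢z w'≢y (w'≢q d≢l) (H.ν-irr d w))
                                        (clean d d≢l) (λ r → w'≢y (cong proj₂ r))
                in finish-free s₃ (free d d≢l w'≢y) free-y (λ u u∉ → trans (out₃ u u∉) (out u u∉))

          module Last (hx : ∀ c → c ≢ c₁ → Hit X (suc c)) (hz : ∀ c → c ≢ l → Hit Z (suc c)) where
            -- The inside edges at `x` except that of colour `c₁`, and at `z` except that of colour
            -- `l`, make 2k faults. Two remain, one killing `X` and one killing `Z`; `RX` and `RZ`
            -- allow either to be specialised to the cross edge.
            module Exact {RX RZ : Fault → Set} (RX⇒ : ∀ {e} → RX e → Kill X e) (RZ⇒ : ∀ {e} → RZ e → Kill Z e)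
                         (rx : ∃ RX) (rz : ∃ RZ) where
              EX EZ : Fault → Set
              EX e = ∃ λ c → c ≢ c₁ × By X (suc c) e
              EZ e = ∃ λ c → c ≢ l × By Z (suc c) e

              family : Distinct (k + (k + (1 + 1))) (λ e → EX e ⊎ EZ e ⊎ RX e ⊎ RZ e)
              family = choose-but c₁ hx (λ {c} {d} p q → proj₁ (by-uniq {i} {x} {x} {c} {d} p q)) ⊕[ d₁ ]
                       choose-but l hz (λ {c} {d} p q → proj₁ (by-uniq {i} {z} {z} {c} {d} p q)) ⊕[ d₂ ]
                       single (proj₁ rx) (proj₂ rx) ⊕[ (λ p q → z≢x (kill-uniq {i} {z} {x} (RZ⇒ q) (RX⇒ p))) ]
                       single (proj₁ rz) (proj₂ rz)
                where
                d₁ : ∀ {e} → EX e → EZ e ⊎ RX e ⊎ RZ e → ⊥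
                d₁ (c , _ , q) (inj₁ (d , _ , r)) with by-uniq {i} {x} {z} {c} {d} q r
                ... | _ , inj₁ t = z≢x (sym t)
                ... | _ , inj₂ t = H.no3 xp pz (H.E-sym (c , t))
                d₁ (c , _ , q) (inj₂ (inj₁ r)) = by-kill {i} {x} {x} {c} q (RX⇒ r)
                d₁ (c , _ , q) (inj₂ (inj₂ r)) = by-kill {i} {x} {z} {c} q (RZ⇒ r)
                d₂ : ∀ {e} → EZ e → RX e ⊎ RZ e → ⊥
                d₂ (c , _ , q) (inj₁ r) = by-kill {i} {z} {x} {c} q (RX⇒ r)
                d₂ (c , _ , q) (inj₂ r) = by-kill {i} {z} {z} {c} q (RZ⇒ r)

              count : suc k + suc k ≡ k + (k + (1 + 1))
              count = trans 2+2k (trans (ℕ.+-comm 2 (k + k)) (ℕ.+-assoc k k 2))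

              exact : ∀ e → EX e ⊎ EZ e ⊎ RX e ⊎ RZ e
              exact = exhaust family (subst (length F ≤_) count few)

            abstract
              -- The hole takes its good cross edge into `a` and slides on to `g₂`, which is free.
              -- Its target is not `i`, the only vertex of `a` leading there being `χ g`; faults
              -- inside `a` do not kill vertices of `a`; and the cross fault at `g'` reaches `a`
              -- only if `g'` equals `g`, whose cross edge is good.
              across : ∀ {g} (s : NearPerfect Good g Y) g' → cp g ≡ i → cp g' ≡ i →
                       (∀ u → cp u ≢ i → NearPerfect.m s u ≡ NearPerfect.m s₀ u) → ¬ Hit g zero →
                       (∀ e → Ins i e ⊎ Kill g e ⊎ By g' zero e) → Perfect Good
              across {g} s g' refl g'∈i out nh faults
                with slide s (χ g) g₂ (trans (out (χ g) (tgt≢ g)) (s₀-out (tgt≢ g)))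
                           (zero , refl , nh) (λ q → tgt≢ g (cong cp q))
                where
                g₂ : P
                g₂ = tgt g , H.ν (κ (tgt g)) (proj₂ (χ g))
              ... | s' , same = endgame s' i a (inj₂ refl) (inj₁ refl) free₂ free-y t₂≢i (tgt≢ g₂) (tgt≢ Y)
                      (λ q → NearPerfect.g≢h s (sym (tgt-inj refl q))) pres
                where
                a : Fin (suc T)
                a = tgt g
                g₂ : P
                g₂ = a , H.ν (κ a) (proj₂ (χ g))
                t₂≢i : tgt g₂ ≢ i
                t₂≢i q = H.ν-irr (κ a) (proj₂ (χ g)) (cong proj₂ (tgt-inj {g₂} {χ g} refl (trans q (sym (tgt-χ g)))))
                free₂ : Free g₂
                free₂ e q with faults e
                free₂ e (inj₁ q) | inj₁ r = cross≢Ins {g₂} q r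
                free₂ e (inj₂ q) | inj₁ r = t₂≢i (Ins-uniq q r)
                free₂ e q | inj₂ (inj₁ (inj₁ r)) = nh (e , r)
                free₂ e q | inj₂ (inj₁ (inj₂ r)) = Kill≢Ins {g₂} q r
                free₂ e (inj₂ q) | inj₂ (inj₂ r) = cross≢Ins {g'} r q
                free₂ e (inj₁ q) | inj₂ (inj₂ r) with proj₂ (By-uniq {g'} {zero} {g₂} {zero} r q)
                ... | inj₁ t = tgt≢ g (trans (sym (cong cp t)) g'∈i)
                ... | inj₂ t = nh (e , subst (λ u → By u zero e) (tgt-inj g'∈i (cong cp t)) r)
                pres : ∀ b → b ≢ i → b ≢ a → Pres s' b
                pres b b≢i b≢a u refl = trans (cong cp (same u (λ { refl → b≢i refl }) (λ { refl → b≢a refl })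
                  (λ { refl → b≢a refl }))) (pres-of s out b b≢i u refl)

            abstract
              -- The cross fault `e₀` lies inside no copy, so it can only be one of the two killing
              -- faults, and then it is the cross edge itself.
              cross-is : Hit X zero ⊎ Hit Z zero
              cross-is with Exact.exact {Kill X} {Kill Z} (λ q → q) (λ q → q) kx kz e₀
                where
                -- The slide from `x` along `c₁` begins with a good edge, so what stops it is a kill
                -- of its landing vertex `z`.
                kz : ∃ (Kill Z)
                kz with sx c₁ c₁≢l
                ... | e , inj₁ q = ⊥-elim (ok (e , q))
                ... | e , inj₂ (_ , q) = e , q
              ... | inj₁ (c , _ , q) = ⊥-elim (cross≢Ins {u₀} cross₀ (By-Ins {i} {x} {c} q))
              ... | inj₂ (inj₁ (c , _ , q)) = ⊥-elim (cross≢Ins {u₀} cross₀ (By-Ins {i} {z} {c} q))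
              ... | inj₂ (inj₂ (inj₁ (inj₁ q))) = inj₁ (e₀ , q)
              ... | inj₂ (inj₂ (inj₁ (inj₂ q))) = ⊥-elim (cross≢Ins {u₀} cross₀ q)
              ... | inj₂ (inj₂ (inj₂ (inj₁ q))) = inj₂ (e₀ , q)
              ... | inj₂ (inj₂ (inj₂ (inj₂ q))) = ⊥-elim (cross≢Ins {u₀} cross₀ q)

            abstract
              last : Perfect Good ⊎ Star
              last with dec-edge X zero | dec-edge Z zero
              ... | inj₂ h | inj₂ h' = inj₂ record
                    { centre = X ; c = suc c₁ ; c' = suc l ; c≢c' = λ q → c₁≢l (suc-injective q)
                    ; cover = cover
                    ; hit-u = λ { zero _ → h ; (suc d) q → hx d (λ r → q (cong suc r)) }
                    ; hit-w = λ { zero _ → h' ; (suc d) q → hz d (λ r → q (cong suc r)) }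
                    ; size = ℕ.≤-trans (ℕ.≤-reflexive count) (bound family) }
                where
                open Exact {By X zero} {By Z zero} inj₁ inj₁ h h'
                cover : ∀ e → (∃ λ d → d ≢ suc c₁ × By X d e) ⊎ (∃ λ d → d ≢ suc l × By Z d e)
                cover e with exact e
                ... | inj₁ (c , c≢ , q) = inj₁ (suc c , (λ r → c≢ (suc-injective r)) , q)
                ... | inj₂ (inj₁ (c , c≢ , q)) = inj₂ (suc c , (λ r → c≢ (suc-injective r)) , q)
                ... | inj₂ (inj₂ (inj₁ q)) = inj₁ (zero , (λ ()) , q)
                ... | inj₂ (inj₂ (inj₂ q)) = inj₂ (zero , (λ ()) , q)
              ... | inj₁ nh | inj₂ h' = inj₁ (across s₀ Z refl refl (λ _ _ → refl) nh faults)
                where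
                open Exact {Kill X} {By Z zero} (λ q → q) inj₁ kx h'
                faults : ∀ e → Ins i e ⊎ Kill X e ⊎ By Z zero e
                faults e with exact e
                ... | inj₁ (c , _ , q) = inj₁ (By-Ins {i} {x} {c} q)
                ... | inj₂ (inj₁ (c , _ , q)) = inj₁ (By-Ins {i} {z} {c} q)
                ... | inj₂ (inj₂ q) = inj₂ q
              ... | _ | inj₁ nh with cross-is
              ...   | inj₂ h' = ⊥-elim (nh h')
              ...   | inj₁ h = inj₁ (across (proj₁ (first ok)) X refl refl (proj₂ (proj₂ (first ok))) nh faults)
                where
                kz : ∃ (Kill Z)
                kz with sx c₁ c₁≢l
                ... | e , inj₁ q = ⊥-elim (ok (e , q))
                ... | e , inj₂ (_ , q) = e , q
                open Exact {By X zero} {Kill Z} inj₁ (λ q → q) h kz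
                faults : ∀ e → Ins i e ⊎ Kill Z e ⊎ By X zero e
                faults e with exact e
                ... | inj₁ (c , _ , q) = inj₁ (By-Ins {i} {x} {c} q)
                ... | inj₂ (inj₁ (c , _ , q)) = inj₁ (By-Ins {i} {z} {c} q)
                ... | inj₂ (inj₂ (inj₁ q)) = inj₂ (inj₂ q)
                ... | inj₂ (inj₂ (inj₂ q)) = inj₂ (inj₁ q)

          abstract
            tight : Perfect Good ⊎ Star
            tight with find-or-but l split
              where
              split : ∀ c → (c ≢ c₁ × ¬ Hit X (suc c)) ⊎ (c ≡ c₁ ⊎ Hit X (suc c))
              split c with c ≟ c₁ | dec-edge X (suc c)
              ... | yes q | _ = inj₂ (inj₁ q)
              ... | no q | inj₁ n = inj₁ (q , n)
              ... | no q | inj₂ h = inj₂ (inj₂ h)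
            ... | inj₁ (c₂ , c₂≢l , c₂≢c₁ , ok₂) = inj₁ (branch c₂ c₂≢l c₂≢c₁ ok₂)
            ... | inj₂ only with find-or-but l (λ c → dec-edge Z (suc c))
            ...   | inj₁ (c , c≢l , ok') = inj₁ (deeper only c c≢l ok')
            ...   | inj₂ hz = Last.last hx hz
              where
              hx : ∀ c → c ≢ c₁ → Hit X (suc c)
              hx c c≢c₁ with c ≟ l
              ... | yes refl = hit-l
              ... | no c≢l with only c c≢l
              ...   | inj₁ q = ⊥-elim (c≢c₁ q)
              ...   | inj₂ h = h

        -- x has lost all its edges inside copy i, so its hole must leave through the cross edge.
        module Stuck (hx : ∀ c → Hit X (suc c)) (kx : ∃ (Kill X)) where
          nX : ¬ Hit X zero
          nX with noiso X
          ... | zero , n = n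
          ... | suc c , n = ⊥-elim (n (hx c))

          a : Fin (suc T)
          a = tgt X

          v : Fin T
          v = proj₂ (χ X)

          a≢i : a ≢ i
          a≢i = tgt≢ X

          unclean : ∃ (Ins a)
          unclean = proj₁ kx , [ (λ q → ⊥-elim (nX (proj₁ kx , q))) , (λ q → q) ]′ (proj₂ kx)

          away : ∀ w → Free (i , w) → tgt (i , w) ≢ a
          away w f q = f (proj₁ unclean) (inj₂ (subst (λ b → Ins b (proj₁ unclean)) (sym q) (proj₂ unclean)))

          to-i : ∀ {w} → tgt (a , w) ≡ i → w ≡ v
          to-i {w} q = cong proj₂ (tgt-inj {a , w} {χ X} refl (trans q (sym (tgt-χ X))))

          -- What prevents colour `c` from matching copy `a` and letting out the hole, which arrives
          -- at `v` and is carried on to `ν c v`.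
          U : Fin (suc k) → Fault → Set
          U c e = InC a c e ⊎ (Unhit a c × Kill (a , H.ν c v) e)

          κ' : Fin (suc k) → Fin (suc T) → Fin (suc k)
          κ' c b with b ≟ a
          ... | yes _ = c
          ... | no _ = κ b

          κ'-a : ∀ c → κ' c a ≡ c
          κ'-a c with a ≟ a
          ... | yes _ = refl
          ... | no q = ⊥-elim (q refl)

          κ'-i : ∀ c → κ' c i ≡ l
          κ'-i c with i ≟ a
          ... | yes q = ⊥-elim (a≢i (sym q))
          ... | no _ = κ-i

          κ'-o : ∀ c → Unhit a c → ∀ b → b ≢ i → Unhit b (κ' c b)
          κ'-o c un b b≢i with b ≟ a
          ... | yes refl = un
          ... | no _ = κ-o b b≢i

          module Enter (c : Fin (suc k)) (un : Unhit a c) where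
            module B = Base (κ' c) (κ'-i c) (κ'-o c un)

            W : P
            W = a , H.ν c v

            B-a : ∀ w → NearPerfect.m B.s₀ (a , w) ≡ (a , H.ν c w)
            B-a w = trans (B.s₀-out a≢i) (cong (λ d → a , H.ν d w) (κ'-a c))

            abstract
              enter : Σ (NearPerfect Good W Y) λ s → ∀ u → u ≢ X → u ≢ χ X → u ≢ W → NearPerfect.m s u ≡ NearPerfect.m B.s₀ u
              enter = slide B.s₀ (χ X) W (B-a v) (zero , refl , nX) (λ q → a≢i (cong cp q))

            route : ∀ d → d ≢ l → NearPerfect.m (proj₁ enter) (i , H.ν d y) ≡ (i , α d y)
            route d d≢l = trans (proj₂ enter (i , H.ν d y) (λ q → y'≢x d≢l (cong proj₂ q))
                (λ q → a≢i (sym (cong cp q))) (λ q → a≢i (sym (cong cp q))))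
              (B.s₀-in (y'≢x d≢l) (H.ν-irr d y))

            pres-enter : ∀ b → b ≢ i → b ≢ a → Pres (proj₁ enter) b
            pres-enter b b≢i b≢a u refl = trans (cong cp (proj₂ enter u (λ { refl → b≢i refl }) (λ { refl → b≢a refl })
              (λ { refl → b≢a refl }))) (B.pres₀ b b≢i u refl)

            w : Fin T
            w = H.ν c v

            w'≢v : ∀ {d} → d ≢ c → H.ν d w ≢ v
            w'≢v d≢c q = d≢c (H.ν-col (trans q (sym (H.ν-inv c v))))

            w''≢v : ∀ d → H.ν c (H.ν d w) ≢ v
            w''≢v d q = H.ν-irr d w (H.ν-inj (trans q (sym (H.ν-inv c v))))

            abstract
              further : ∀ d → d ≢ c → ¬ Hit W (suc d) →
                        Σ (NearPerfect Good (a , H.ν c (H.ν d w)) Y) λ s →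
                          ∀ u → cp u ≢ a → NearPerfect.m s u ≡ NearPerfect.m (proj₁ enter) u
              further d d≢c ok = proj₁ slid , λ u u∉a → proj₂ slid u (λ { refl → u∉a refl }) (λ { refl → u∉a refl })
                                                (λ { refl → u∉a refl })
                where
                m-w' : NearPerfect.m (proj₁ enter) (a , H.ν d w) ≡ (a , H.ν c (H.ν d w))
                m-w' = trans (proj₂ enter (a , H.ν d w) (λ q → a≢i (cong cp q)) (λ q → w'≢v d≢c (cong proj₂ q))
                               (λ q → H.ν-irr d w (cong proj₂ q)))
                         (B-a (H.ν d w))
                slid : Σ (NearPerfect Good (a , H.ν c (H.ν d w)) Y) λ s → ∀ u → u ≢ W → u ≢ (a , H.ν d w) →
                       u ≢ (a , H.ν c (H.ν d w)) → NearPerfect.m s u ≡ NearPerfect.m (proj₁ enter) u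
                slid = slide (proj₁ enter) (a , H.ν d w) (a , H.ν c (H.ν d w)) m-w' (suc d , refl , ok)
                         (λ q → a≢i (cong cp q))

              onward : ∀ d → d ≢ c → ¬ Hit W (suc d) → Free (a , H.ν c (H.ν d w)) → Perfect Good
              onward d d≢c ok free = finish (proj₁ (further d d≢c ok)) a (inj₂ refl) free
                (λ q → w''≢v d (to-i q)) (tgt≢ (a , H.ν c (H.ν d w))) pres away ey
                (λ e e≢l → inj₂ (trans (proj₂ (further d d≢c ok) (i , H.ν e y) (λ q → a≢i (sym q))) (route e e≢l)))
                where
                pres : ∀ b → b ≢ i → b ≢ a → Pres (proj₁ (further d d≢c ok)) b
                pres b b≢i b≢a u refl = trans (cong cp (proj₂ (further d d≢c ok) u b≢a)) (pres-enter b b≢i b≢a u refl)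

          module Trapped (all-U : ∀ c → ∃ (U c)) where
            EX : Fault → Set
            EX e = ∃ λ c → By X (suc c) e

            abstract
              family : Distinct (suc k) EX
              family = choose hx (λ {c} {d} p q → proj₁ (by-uniq {i} {x} {x} {c} {d} p q))

              exact : ∀ e → EX e ⊎ ∃ λ c → U c e
              exact = exhaust (family ⊕[ d₁ ] choose all-U d₂) few
                where
                d₁ : ∀ {e} → EX e → (∃ λ c → U c e) → ⊥
                d₁ (c , q) (d , inj₁ r) = a≢i (Ins-uniq (InC-Ins r) (By-Ins {i} {x} {c} q))
                d₁ (c , q) (d , inj₂ (_ , inj₁ r)) = cross≢Ins {a , H.ν d v} r (By-Ins {i} {x} {c} q)
                d₁ (c , q) (d , inj₂ (_ , inj₂ r)) = H.ν-irr d v (to-i (Ins-uniq r (By-Ins {i} {x} {c} q)))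
                d₂ : ∀ {c d e} → U c e → U d e → c ≡ d
                d₂ (inj₁ q) (inj₁ r) = InC-uniq q r
                d₂ {c} {d} (inj₁ q) (inj₂ (_ , r)) = ⊥-elim (Kill≢Ins {a , H.ν d v} r (InC-Ins q))
                d₂ {c} {d} (inj₂ (_ , r)) (inj₁ q) = ⊥-elim (Kill≢Ins {a , H.ν c v} r (InC-Ins q))
                d₂ {c} {d} (inj₂ (_ , q)) (inj₂ (_ , r)) = H.ν-col (kill-uniq {a} {H.ν c v} {H.ν d v} q r)

              -- The `k + 1` edges at `X` inside `i` and one fault for each of the `k + 1` colours
              -- of `a` exhaust `F`. Among these, `e₀` can only be the cross edge at some `ν c v`.
              cross-fault : ∃ λ c → Unhit a c × Hit (a , H.ν c v) zero
              cross-fault with exact e₀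
              ... | inj₁ (c , q) = ⊥-elim (cross≢Ins {u₀} cross₀ (By-Ins {i} {x} {c} q))
              ... | inj₂ (c , inj₁ q) = ⊥-elim (cross≢Ins {u₀} cross₀ (InC-Ins q))
              ... | inj₂ (c , inj₂ (un , inj₁ q)) = c , un , e₀ , q
              ... | inj₂ (c , inj₂ (un , inj₂ q)) = ⊥-elim (cross≢Ins {u₀} cross₀ q)

            module Caught (c₀ : Fin (suc k)) (unhit₀ : Unhit a c₀) (hitW : Hit (a , H.ν c₀ v) zero) where
              open Enter c₀ unhit₀

              -- By `exact` only neighbours of `v` are killed in copy `a`, apart from the vertex
              -- leading to `i`, which is `v`. The landing vertex is not such a neighbour: with `v`,
              -- `w` and `ν c w` it would form a 4-cycle.
              free-onward : ∀ c → c ≢ c₀ → Free (a , H.ν c₀ (H.ν c w))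
              free-onward c c≢c₀ e q with exact e
              free-onward c c≢c₀ e (inj₁ q) | inj₁ (d , r) = cross≢Ins {a , H.ν c₀ (H.ν c w)} q (By-Ins {i} {x} {d} r)
              free-onward c c≢c₀ e (inj₂ q) | inj₁ (d , r) = w''≢v c (to-i (Ins-uniq q (By-Ins {i} {x} {d} r)))
              free-onward c c≢c₀ e q | inj₂ (d , inj₁ r) = Kill≢Ins {a , H.ν c₀ (H.ν c w)} q (InC-Ins r)
              free-onward c c≢c₀ e q | inj₂ (d , inj₂ (_ , r)) =
                H.no4 (H.edge c₀ v) (H.edge c w) (H.edge c₀ (H.ν c w))
                  (H.E-sym (d , sym (kill-uniq {a} {H.ν c₀ (H.ν c w)} {H.ν d v} q r)))
                  (λ t → w'≢v c≢c₀ (sym t)) (λ t → w'≢v c≢c₀ (H.ν-inj (sym t)))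

              abstract
                -- The second shape of the trivial solution: the middle vertex of the path is `χ X`,
                -- so one end lies in `i` and the other in `a`.
                star : (∀ c → c ≢ c₀ → Hit W (suc c)) → Star
                star hw = record
                  { centre = X ; c = zero ; c' = suc c₀ ; c≢c' = λ () ; cover = cover
                  ; hit-u = λ { zero q → ⊥-elim (q refl) ; (suc d) _ → hx d }
                  ; hit-w = λ { zero _ → hitW ; (suc d) q → hw d (λ r → q (cong suc r)) }
                  ; size = ℕ.≤-trans (ℕ.≤-reflexive count) (bound whole) }
                  where
                  EW : Fault → Set
                  EW e = ∃ λ c → c ≢ c₀ × By W (suc c) e
                  d₁ : ∀ {e} → EX e → EW e ⊎ By W zero e → ⊥
                  d₁ (c , q) (inj₁ (d , _ , r)) = a≢i (Ins-uniq (By-Ins {a} {w} {d} r) (By-Ins {i} {x} {c} q))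
                  d₁ (c , q) (inj₂ r) = cross≢Ins {W} r (By-Ins {i} {x} {c} q)
                  whole : Distinct (suc k + (k + 1)) (λ e → EX e ⊎ EW e ⊎ By W zero e)
                  whole = family ⊕[ d₁ ]
                    choose-but c₀ hw (λ {c} {d} p q → proj₁ (by-uniq {a} {w} {w} {c} {d} p q)) ⊕[
                      (λ { (d , _ , r) q → cross≢Ins {W} q (By-Ins {a} {w} {d} r) }) ]
                    single (proj₁ hitW) (proj₂ hitW)
                  count : suc k + suc k ≡ suc k + (k + 1)
                  count = cong (suc k +_) (ℕ.+-comm 1 k)
                  cover : ∀ e → (∃ λ d → d ≢ zero × By X d e) ⊎ (∃ λ d → d ≢ suc c₀ × By W d e)
                  cover e with exhaust whole (subst (length F ≤_) count few) e
                  ... | inj₁ (c , q) = inj₁ (suc c , (λ ()) , q)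
                  ... | inj₂ (inj₁ (c , c≢ , q)) = inj₂ (suc c , (λ r → c≢ (suc-injective r)) , q)
                  ... | inj₂ (inj₂ q) = inj₂ (zero , (λ ()) , q)

              result : Perfect Good ⊎ Star
              result with find-or-but c₀ (λ c → dec-edge W (suc c))
              ... | inj₁ (c , c≢c₀ , ok) = inj₁ (onward c c≢c₀ ok (free-onward c c≢c₀))
              ... | inj₂ hw = inj₂ (star hw)

            outcome : Perfect Good ⊎ Star
            outcome = let (c , un , h) = cross-fault in Caught.result c un h

          escape : ∀ c → Unhit a c → Free (a , H.ν c v) → Perfect Good
          escape c un f = finish (proj₁ enter) a (inj₂ refl) f (λ q → H.ν-irr c v (to-i q)) (tgt≢ W)
            pres-enter away ey (λ d d≢l → inj₂ (route d d≢l))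
            where open Enter c un

          stuck : Perfect Good ⊎ Star
          stuck with find-or dec
            where
            dec : ∀ c → (Unhit a c × Free (a , H.ν c v)) ⊎ ∃ (U c)
            dec c with dec-hit a c | free? (a , H.ν c v)
            ... | inj₂ (e , q) | _ = inj₂ (e , inj₁ q)
            ... | inj₁ un | inj₁ f = inj₁ (un , f)
            ... | inj₁ un | inj₂ (e , q) = inj₂ (e , inj₂ (un , q))
          ... | inj₁ (c , un , f) = inj₁ (escape c un f)
          ... | inj₂ all-U = Trapped.outcome all-U

        all-hit : (∀ c → c ≢ l → Hit X (suc c)) → ∀ c → Hit X (suc c)
        all-hit hx c with c ≟ l
        ... | yes refl = hit-l
        ... | no c≢l = hx c c≢l

        from-exit : Exit x → Perfect Good
        from-exit (inj₁ f) = depth₀ f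
        from-exit (inj₂ (c , c≢l , ok , f)) = depth₁ c c≢l ok f

        from-blocked : Blocked x → Perfect Good ⊎ Star
        from-blocked (kx , sx) = [ through , (λ hx → Stuck.stuck (all-hit hx) kx) ]′
          (find-or-but l (λ c → dec-edge X (suc c)))
          where
          through : (∃ λ c → c ≢ l × ¬ Hit X (suc c)) → Perfect Good ⊎ Star
          through (c , c≢l , ok) =
            [ (λ { (d , d≢l , ok' , f) → inj₁ (depth₂ c c≢l ok d d≢l ok' f) })
            , (λ sz → Tight.tight c c≢l ok kx sx sz) ]′ (explore (α c x))

        found : Perfect Good ⊎ Star
        found = [ (λ ex → inj₁ (from-exit ex)) , from-blocked ]′ (exit? x)

-- Choice of the copy and of the colour

module Solve {T k : ℕ} (2≤k : 2 ≤ k) (H : Coloured (Fin T) (suc k)) (bc : Bicritical H)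
             (F : List (Cross.P T × Cross.P T))
             (room : length F + (length F + 4) < suc T) (few : length F ≤ suc k + suc k) where
  open Step 2≤k H bc F public
  open Overfull room few public

  module Cover (noiso : ∀ u → ∃ λ c → ¬ Hit u c) (e₀ : Fault) (u₀ : P) (cross₀ : By u₀ zero e₀) where

    module Dense (i : Fin (suc T)) (full : ∀ c → ∃ (InC i c)) where

      abstract
        -- A second copy in which every colour is hit would bring the count to 2(k + 1) + 1, the
        -- last fault being the cross edge `e₀`.
        others : ∀ b → b ≢ i → ∃ (Unhit b)
        others b b≢i with find-or (dec-hit b)
        ... | inj₁ p = p
        ... | inj₂ full' = ⊥-elim (over
              (choose full InC-uniq ⊕[ d₁ ] choose full' InC-uniq ⊕[ (λ { (_ , q) refl → no-cross q }) ] single e₀ refl)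
              (ℕ.≤-reflexive (sym (trans (cong (suc k +_) (ℕ.+-comm (suc k) 1)) (ℕ.+-suc (suc k) (suc k))))))
          where
          no-cross : ∀ {b c} → ¬ InC b c e₀
          no-cross q = cross≢Ins {u₀} cross₀ (InC-Ins q)
          d₁ : ∀ {e} → (∃ λ c → InC i c e) → ((∃ λ c → InC b c e) ⊎ e ≡ e₀) → ⊥
          d₁ (_ , q) (inj₁ (_ , r)) = b≢i (Ins-uniq (InC-Ins r) (InC-Ins q))
          d₁ (_ , q) (inj₂ refl) = no-cross q

        -- Two faults in each of the `k + 1` colours of copy `i`, together with `e₀`, would again be
        -- one too many.
        once : ∃ λ l → ∀ e → InC i l e → e ≡ proj₁ (full l)
        once with find-or dec
          where
          dec : ∀ c → (∀ e → InC i c e → e ≡ proj₁ (full c)) ⊎ ∃ λ e → InC i c e × e ≢ proj₁ (full c)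
          dec c with any? (λ e → inC? i c e ×-dec ¬? (e ≟ proj₁ (full c)))
          ... | yes p = inj₂ p
          ... | no ∄e = inj₁ eq
            where
            eq : ∀ e → InC i c e → e ≡ proj₁ (full c)
            eq e q with e ≟ proj₁ (full c)
            ... | yes r = r
            ... | no r = ⊥-elim (∄e (e , q , r))
        ... | inj₁ p = p
        ... | inj₂ twice = ⊥-elim (over
              (choose one (λ {c} {d} → uniq₁ {c} {d}) ⊕[ d₁ ] choose twice uniq₂ ⊕[ (λ { (_ , q , _) refl → no-cross q }) ] single e₀ refl)
              (ℕ.≤-reflexive (sym (trans (cong (suc k +_) (ℕ.+-comm (suc k) 1)) (ℕ.+-suc (suc k) (suc k))))))
          where
          no-cross : ∀ {c} → ¬ InC i c e₀
          no-cross q = cross≢Ins {u₀} cross₀ (InC-Ins q)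
          one : ∀ c → ∃ λ e → e ≡ proj₁ (full c)
          one c = proj₁ (full c) , refl
          is : ∀ {c e} → e ≡ proj₁ (full c) → InC i c e
          is {c} refl = proj₂ (full c)
          uniq₁ : ∀ {c d e} → e ≡ proj₁ (full c) → e ≡ proj₁ (full d) → c ≡ d
          uniq₁ q r = InC-uniq (is q) (is r)
          uniq₂ : ∀ {c d e} → InC i c e × e ≢ proj₁ (full c) → InC i d e × e ≢ proj₁ (full d) → c ≡ d
          uniq₂ (q , _) (r , _) = InC-uniq q r
          d₁ : ∀ {e} → (∃ λ c → e ≡ proj₁ (full c)) →
               ((∃ λ c → InC i c e × e ≢ proj₁ (full c)) ⊎ e ≡ e₀) → ⊥
          d₁ (c , q) (inj₁ (d , r , r')) with InC-uniq (is q) r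
          ... | refl = r' q
          d₁ (c , q) (inj₂ refl) = no-cross (is q)

      l : Fin (suc k)
      l = proj₁ once

      κ : Fin (suc T) → Fin (suc k)
      κ b with b ≟ i
      ... | yes _ = l
      ... | no p = proj₁ (others b p)

      κ-i : κ i ≡ l
      κ-i with i ≟ i
      ... | yes _ = refl
      ... | no p = ⊥-elim (p refl)

      κ-o : ∀ b → b ≢ i → Unhit b (κ b)
      κ-o b b≢i with b ≟ i
      ... | yes p = ⊥-elim (b≢i p)
      ... | no p = proj₂ (others b p)

      x y : Fin T
      x = proj₁ (proj₂ (full l))
      y = H.ν l x

      by-x : By (i , x) (suc l) (proj₁ (full l))
      by-x = proj₂ (proj₂ (full l))

      hit-x : Hit (i , x) (suc l)
      hit-x = _ , by-x

      hit-y : Hit (i , y) (suc l)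
      hit-y = _ , By-rev {i , y} {suc l} (subst (λ w → By (i , w) (suc l) (proj₁ (full l))) (sym (H.ν-inv l x)) by-x)

      only-x : ∀ w → Hit (i , w) (suc l) → w ≡ x ⊎ w ≡ H.ν l x
      only-x w (e , q) with proj₂ once e (w , q)
      ... | refl with proj₂ (by-uniq {i} {x} {w} {l} {l} by-x q)
      ...   | inj₁ r = inj₁ (sym r)
      ...   | inj₂ r = inj₂ (sym r)

      only-y : ∀ w → Hit (i , w) (suc l) → w ≡ y ⊎ w ≡ H.ν l y
      only-y w h with only-x w h
      ... | inj₁ r = inj₂ (trans r (sym (H.ν-inv l x)))
      ... | inj₂ r = inj₁ r

      module CX = Copy i l e₀ u₀ cross₀ κ κ-i κ-o noiso x hit-x only-x
      module CY = Copy i l e₀ u₀ cross₀ κ κ-i κ-o noiso y hit-y only-y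

      -- The situation is symmetric in `x` and `y`. By `not-both` one of them has an exit, and that
      -- one takes the part of `y`.
      dense : Perfect Good ⊎ Star
      dense with CX.exit? y | CX.exit? x
      ... | inj₁ ey | _ = CX.Found.found ey
      ... | inj₂ _ | inj₁ ex = CY.Found.found (subst CX.Exit (sym (H.ν-inv l x)) ex)
      ... | inj₂ by | inj₂ bx = ⊥-elim (CX.not-both bx by)

    covered : Perfect Good ⊎ Star
    covered with find-or dec
      where
      dec : ∀ b → (∀ c → ∃ (InC b c)) ⊎ ∃ (Unhit b)
      dec b with find-or (dec-hit b)
      ... | inj₁ p = inj₂ p
      ... | inj₂ p = inj₁ p
    ... | inj₁ (i , full) = Dense.dense i full
    ... | inj₂ col = inj₁ (m , λ u → good u , cong (cp u ,_) (H.ν-inv (proj₁ (col (cp u))) (proj₂ u)))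
      where
      m : P → P
      m (b , w) = b , H.ν (proj₁ (col b)) w
      good : ∀ u → Good u (m u)
      good (b , w) = suc (proj₁ (col b)) , refl , λ { (e , q) → proj₂ (col b) e (w , q) }

  perfect-or-star : (∀ u → ∃ λ c → ¬ Hit u c) → Perfect Good ⊎ Star
  perfect-or-star noiso with any? (λ i → any? (λ j → hit? (i , j) zero))
  ... | yes (i , j , e , q) = Cover.covered noiso e (i , j) q
  ... | no ∄ = inj₁ (χ , λ u → (zero , refl , λ h → ∄ (proj₁ u , proj₂ u , h)) , χ-inv u)

-- Bicriticality is inherited by the product

module _ {T r : ℕ} (4≤T : 4 ≤ T) (H : Coloured (Fin T) (suc r)) (bc : Bicritical H) where
  private
    open module N = Faulty H bc [] using (P; χ; tgt; tgt-χ; tgt≢; port; tgt-inj; cp; Good; EP; Pres; teleport; exchange)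
    open N.Routing (s≤s 4≤T) using (untouched)
    module G = Coloured H

    same-copy : ∀ i {j j'} → j ≢ j' → Σ (NearPerfect Good (i , j) (i , j')) λ s → ∀ b → b ≢ i → Pres s b
    same-copy i {j} {j'} j≢j' = record
        { m = m ; g≢h = λ p → j≢j' (cong proj₂ p) ; mg = m-i (NearPerfect.mg inner) ; mh = m-i (NearPerfect.mh inner)
        ; invo = invo ; good = good } , λ { b b≢i u refl → cp-m u }
      where
      inner : NearPerfect G.E j j'
      inner = bc j≢j'
      n : Fin (suc T) → Fin T → Fin T
      n b w with b ≟ i
      ... | yes _ = NearPerfect.m inner w
      ... | no _ = G.ν zero w
      m : P → P
      m u = cp u , n (cp u) (proj₂ u)
      cp-m : ∀ u → cp (m u) ≡ cp u
      cp-m u = refl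
      m-i : ∀ {w w'} → NearPerfect.m inner w ≡ w' → m (i , w) ≡ (i , w')
      m-i p with i ≟ i
      ... | yes _ = cong (i ,_) p
      ... | no q = ⊥-elim (q refl)
      invo : ∀ u → m (m u) ≡ u
      invo (b , w) with b ≟ i
      ... | yes _ = cong (b ,_) (NearPerfect.invo inner w)
      ... | no _ = cong (b ,_) (G.ν-inv zero w)
      good : ∀ u → u ≢ (i , j) → u ≢ (i , j') → Good u (m u)
      good (b , w) p q with b ≟ i
      ... | no _ = suc zero , refl , λ ()
      ... | yes refl with NearPerfect.good inner w (λ { refl → p refl }) (λ { refl → q refl })
      ...   | c , e = suc c , cong (b ,_) e , λ ()

    forget : ∀ {x y} → NearPerfect Good x y → NearPerfect EP x y
    forget s = record { m = m ; g≢h = g≢h ; mg = mg ; mh = mh ; invo = invo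
                      ; good = λ u p q → let (c , e , _) = good u p q in c , e }
      where open NearPerfect s

  abstract
    -- For holes in different copies, one hole starts at the vertex of copy `i` leading to a spare
    -- copy `c` and passes through `c` into `i'`. Avoiding `tgt x` keeps its starting point apart
    -- from `x`; avoiding `tgt y` keeps its entrance to `i'` apart from `y`.
    product-bicritical : Bicritical (Product.product H)
    product-bicritical {i , j} {i' , j'} x≢y with i ≟ i'
    ... | yes refl = forget (proj₁ (same-copy i (λ { refl → x≢y refl })))
    ... | no i≢i' = forget (exchange (proj₁ s₃))
      where
      x y : P
      x = i , j
      y = i' , j'
      spare : ∃ λ c → (c ≢ i × c ≢ i' × c ≢ tgt x × c ≢ tgt y) × N.Routing.Untouched (s≤s 4≤T) c
      spare = untouched i i' (tgt x) (tgt y)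
      c : Fin (suc T)
      c = proj₁ spare
      c≢i : c ≢ i
      c≢i = proj₁ (proj₁ (proj₂ spare))
      c≢i' : c ≢ i'
      c≢i' = proj₁ (proj₂ (proj₁ (proj₂ spare)))
      c≢tx : c ≢ tgt x
      c≢tx = proj₁ (proj₂ (proj₂ (proj₁ (proj₂ spare))))
      c≢ty : c ≢ tgt y
      c≢ty = proj₂ (proj₂ (proj₂ (proj₁ (proj₂ spare))))
      p : ∃ λ a → tgt (i , a) ≡ c
      p = port (λ q → c≢i (sym q))
      q : ∃ λ a → tgt (c , a) ≡ i'
      q = port c≢i'
      s₁ : Σ (NearPerfect Good (i , proj₁ p) x) λ s → ∀ b → b ≢ i → Pres s b
      s₁ = same-copy i (λ e → c≢tx (trans (sym (proj₂ p)) (cong (λ a → tgt (i , a)) e)))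
      s₂ : Σ (NearPerfect Good (c , proj₁ q) x) λ s → ∀ u → cp u ≢ c → u ≢ (i , proj₁ p) → NearPerfect.m s u ≡ NearPerfect.m (proj₁ s₁) u
      s₂ = teleport (proj₁ s₁) c (proj₁ q) (proj₂ p) (λ ()) (proj₂ s₁ c c≢i) (λ e → c≢i (sym e))
             (λ e → i≢i' (trans (sym (tgt-χ (i , proj₁ p))) (trans (cong tgt (sym e)) (proj₂ q))))
      s₃ : Σ (NearPerfect Good (i' , j') x) λ s → ∀ u → cp u ≢ i' → u ≢ (c , proj₁ q) → NearPerfect.m s u ≡ NearPerfect.m (proj₁ s₂) u
      s₃ = teleport (proj₁ s₂) i' j' (proj₂ q) (λ ())
             (λ { u refl → trans (cong cp (proj₂ s₂ u (λ e → c≢i' (sym e)) (λ e → i≢i' (sym (cong cp e)))))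
                                 (proj₂ s₁ i' (λ e → i≢i' (sym e)) u refl) })
             i≢i'
             (λ e → c≢ty (trans (sym (tgt-χ (c , proj₁ q))) (cong tgt (sym e))))

-- Relabelling along a bijection

module Transport {A B : Set} (f : A → B) (g : B → A) (gf : ∀ a → g (f a) ≡ a) (fg : ∀ b → f (g b) ≡ b) where

  module _ {r : ℕ} (G : Coloured A r) where
    private
      module G = Coloured G

    νB : Fin r → B → B
    νB c b = f (G.ν c (g b))

    EB : B → B → Set
    EB u v = ∃ λ c → νB c u ≡ v

    pull : ∀ {u v} → EB u v → G.E (g u) (g v)
    pull (c , p) = c , trans (sym (gf _)) (cong g p)

    push : ∀ {u v} → G.E (g u) (g v) → EB u v
    push {u} {v} (c , p) = c , trans (cong f p) (fg v)

    g-inj : ∀ {u v} → g u ≡ g v → u ≡ v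
    g-inj {u} {v} p = trans (sym (fg u)) (trans (cong f p) (fg v))

    transport : Coloured B r
    transport = record
      { ν     = νB
      ; ν-inv = λ c u → trans (cong (λ a → f (G.ν c a)) (gf _)) (trans (cong f (G.ν-inv c (g u))) (fg u))
      ; ν-irr = λ c u p → G.ν-irr c (g u) (trans (sym (gf _)) (cong g p))
      ; ν-col = λ {c} {d} {u} p → G.ν-col (trans (sym (gf _)) (trans (cong g p) (gf _)))
      ; no3   = λ p q r → G.no3 (pull p) (pull q) (pull r)
      ; no4   = λ p q r s a≢c b≢d → G.no4 (pull p) (pull q) (pull r) (pull s)
                  (λ e → a≢c (g-inj e)) (λ e → b≢d (g-inj e))
      ; no5   = λ p q r s t → G.no5 (pull p) (pull q) (pull r) (pull s) (pull t)
      }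

    transport-bicritical : Bicritical G → Bicritical transport
    transport-bicritical bc {x} {y} x≢y = record
      { m = λ b → f (m (g b))
      ; g≢h = x≢y
      ; mg = trans (cong f mg) (fg x)
      ; mh = trans (cong f mh) (fg y)
      ; invo = λ u → trans (cong (λ a → f (m a)) (gf _)) (trans (cong f (invo (g u))) (fg u))
      ; good = λ u p q → push (subst (G.E (g u)) (sym (gf _)) (good (g u) (λ e → p (g-inj e)) (λ e → q (g-inj e))))
      }
      where open NearPerfect (bc {g x} {g y} (λ e → x≢y (g-inj e)))

-- The DCells as coloured graphs

K₂ : Coloured (Fin 2) 1
K₂ = record
  { ν = λ _ → flip ; ν-inv = λ _ → flip-flip ; ν-irr = λ _ → flip≢ ; ν-col = λ { {zero} {zero} _ → refl }
  ; no3 = λ { (_ , refl) (_ , refl) (_ , p) → flip≢ _ (trans (cong flip (sym (flip-flip _))) p) }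
  ; no4 = λ { (_ , refl) (_ , refl) _ _ p _ → p (sym (flip-flip _)) }
  ; no5 = λ { {a} (_ , refl) (_ , refl) (_ , refl) (_ , refl) (_ , p) →
            flip≢ a (trans (cong flip (sym (trans (flip-flip _) (flip-flip a)))) p) }
  }
  where
  flip : Fin 2 → Fin 2
  flip zero = suc zero
  flip (suc zero) = zero
  flip-flip : ∀ u → flip (flip u) ≡ u
  flip-flip zero = refl
  flip-flip (suc zero) = refl
  flip≢ : ∀ u → flip u ≢ u
  flip≢ zero ()
  flip≢ (suc zero) ()

module Uid (T : ℕ) where
  split : Fin (suc T * T) → Cross.P T
  split = remQuot T

  merge : Cross.P T → Fin (suc T * T)
  merge (i , j) = combine i j

  split-merge : ∀ u → split (merge u) ≡ u
  split-merge (i , j) = remQuot-combine i j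

  merge-split : ∀ v → merge (split v) ≡ v
  merge-split v = combine-remQuot {suc T} T v

DCell : ∀ k → Coloured (Fin (t k 2)) (suc k)
DCell zero = K₂
DCell (suc k) = Transport.transport merge split split-merge merge-split (Product.product (DCell k))
  where open Uid (t k 2)

-- A vector of colours is a choice of one edge at every vertex; it is proper if these edges form a perfect matching.
module CubicColourings {n : ℕ} (G : Coloured (Fin n) 3) where
  open Coloured G

  Proper : Vec (Fin 3) n → Set
  Proper P = ∀ u → Vec.lookup P (ν (Vec.lookup P u) u) ≡ Vec.lookup P u

  On : Fin n → Fin 3 → Fin n → Set
  On v c u = u ≡ v ⊎ u ≡ ν c v

  Isolates : Fin n → Fin n → Fin n → Fin n → Set
  Isolates u₀ u₁ u₂ v = On v zero u₀ × On v (suc zero) u₁ × On v (suc (suc zero)) u₂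

  Avoids : Fin n → Fin n → Fin n → Vec (Fin 3) n → Set
  Avoids u₀ u₁ u₂ P = Vec.lookup P u₀ ≢ zero × Vec.lookup P u₁ ≢ suc zero × Vec.lookup P u₂ ≢ suc (suc zero)

-- Three faults in a cubic graph

module ThreeFaults {n : ℕ} (G : Coloured (Fin n) 3)
    (avoidable : ∀ u₀ u₁ u₂ → (∃ λ P → CubicColourings.Proper G P × CubicColourings.Avoids G u₀ u₁ u₂ P) ⊎
       ∃ (CubicColourings.Isolates G u₀ u₁ u₂))
    (F : List (Fin n × Fin n)) (few : length F ≤ 3) where
  open Coloured G
  open CubicColourings G
  open Faults G _≟_ F

  -- A fault-free colour is a perfect matching by itself. Otherwise the at most three faults are one
  -- of each colour, so it suffices to treat triples of edges of different colours, each given by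
  -- one of its ends.
  matched : (∀ u → ∃ λ c → ¬ Hit u c) → Perfect Good
  matched noiso with find-or dec
    where
    dec : ∀ c → (∀ u → ¬ Hit u c) ⊎ (∃ λ e → ∃ λ u → By u c e)
    dec c with any? (λ u → hit? u c)
    ... | yes (u , e , p) = inj₂ (e , u , p)
    ... | no p = inj₁ (λ u h → p (u , h))
  ... | inj₁ (c , un) = ν c , λ u → (c , refl , un u) , ν-inv c u
  ... | inj₂ hit = conclude (avoidable (w zero) (w (suc zero)) (w (suc (suc zero))))
    where
    w : Fin 3 → Fin n
    w c = proj₁ (proj₂ (hit c))
    by : ∀ c → By (w c) c (proj₁ (hit c))
    by c = proj₂ (proj₂ (hit c))
    exact : ∀ e → ∃ λ c → By (w c) c e
    exact = exhaust (choose (λ c → proj₁ (hit c) , by c) (λ {c} {d} p q → proj₁ (By-uniq {w c} {c} {w d} {d} p q))) few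
    on-hit : ∀ v c → On v c (w c) → Hit v c
    on-hit v c (inj₁ p) = _ , subst (λ u → By u c (proj₁ (hit c))) p (by c)
    on-hit v c (inj₂ p) = _ , By-rev {v} {c} (subst (λ u → By u c (proj₁ (hit c))) p (by c))
    isolated : ∀ v → Isolates (w zero) (w (suc zero)) (w (suc (suc zero))) v → ⊥
    isolated v (p , q , r) with noiso v
    ... | zero , n = n (on-hit v zero p)
    ... | suc zero , n = n (on-hit v (suc zero) q)
    ... | suc (suc zero) , n = n (on-hit v (suc (suc zero)) r)
    use : ∀ P → Proper P → (∀ c → Vec.lookup P (w c) ≢ c) → Perfect Good
    use P proper avoids = (λ u → ν (Vec.lookup P u) u) , λ u → (Vec.lookup P u , refl , unhit u) ,
      trans (cong (λ c → ν c (ν (Vec.lookup P u) u)) (proper u)) (ν-inv (Vec.lookup P u) u)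
      where
      unhit : ∀ u → ¬ Hit u (Vec.lookup P u)
      unhit u (e , p) with exact e
      ... | d , q with By-uniq {u} {Vec.lookup P u} {w d} {d} p q
      ...   | r , inj₁ s = avoids d (trans (cong (Vec.lookup P) (sym s)) r)
      ...   | r , inj₂ s = avoids d (trans (cong (Vec.lookup P) (sym s)) (trans (proper u) r))
    conclude : (∃ λ P → Proper P × Avoids (w zero) (w (suc zero)) (w (suc (suc zero))) P) ⊎
               ∃ (Isolates (w zero) (w (suc zero)) (w (suc (suc zero)))) → Perfect Good
    conclude (inj₁ (P , proper , p , q , r)) =
      use P proper (λ { zero → p ; (suc zero) → q ; (suc (suc zero)) → r })
    conclude (inj₂ (v , p)) = ⊥-elim (isolated v p)

-- Computations in D_{2,2}

module D₂ where
  open CubicColourings (DCell 2)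

  open Coloured (DCell 2)

  -- A (near-)perfect matching of D₂ as the vector of the colours of its edges; the colour 3 marks a hole.
  Colours : Set
  Colours = Vec (Fin 4) 42

  hole : Fin 4
  hole = suc (suc (suc zero))

  colour : Fin 3 → Fin 4
  colour zero = zero
  colour (suc zero) = suc zero
  colour (suc (suc zero)) = suc (suc zero)

  -- The digits 1, 2, 3 encode the colours 0, 1, 2, least significant digit first.
  digit : ℕ → Fin 3
  digit 1 = zero
  digit 2 = suc zero
  digit _ = suc (suc zero)

  decode : ∀ n → ℕ → Vec (Fin 3) n
  decode zero _ = []
  decode (suc n) x = digit (x % 10) ∷ decode n (x / 10)

  -- Thirteen perfect matchings, enough for every triple of edges of three different colours to be
  -- avoided by one of them unless the triple isolates a vertex; `check₀` verifies this.
  family : List (Vec (Fin 3) 42)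
  family = decode 42 333333222222222121222121331111333311331111
    ∷ decode 42 222121333311331133331212121222212133113333
    ∷ decode 42 113311111133113311212133212133121222121222
    ∷ decode 42 111212113311113333123321333311113311212111
    ∷ decode 42 121222121222331212111212333333331133333333
    ∷ decode 42 331133331133331133111111111133222121222121
    ∷ decode 42 333311212111212212333333212212111212113333
    ∷ decode 42 212133222222123321333333123321333333331212
    ∷ decode 42 331133333333222121123321121222333333331133
    ∷ decode 42 222121222121331111331133111111331212111212
    ∷ decode 42 113333111212113333212212333311212111333311
    ∷ decode 42 113311123321123321222121222121123321111111
    ∷ decode 42 333311212212212111333311331212111111121121
    ∷ []

  -- A Boolean quantifier, so that the large checks hold by `refl` on truth values.
  every : ∀ {n} → (Fin n → Bool) → Bool
  every {zero} p = true
  every {suc n} p = p zero ∧ every (λ u → p (suc u))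

  every-sound : ∀ {n} (p : Fin n → Bool) → every p ≡ true → ∀ u → p u ≡ true
  every-sound {suc n} p q u with p zero in eq
  every-sound {suc n} p q zero | true = eq
  every-sound {suc n} p q (suc u) | true = every-sound (λ u → p (suc u)) q u

  abstract
    family-proper : All Proper family
    family-proper = from-yes (All.all? (λ P → all? (λ u → Vec.lookup P (ν (Vec.lookup P u) u) ≟ Vec.lookup P u)) family)

  on? : ∀ v c u → Dec (On v c u)
  on? v c u = (u ≟ v) ⊎-dec (u ≟ ν c v)

  iso? : ∀ u₀ u₁ u₂ v → Dec (Isolates u₀ u₁ u₂ v)
  iso? u₀ u₁ u₂ v = on? v zero u₀ ×-dec on? v (suc zero) u₁ ×-dec on? v (suc (suc zero)) u₂

  survivors : Fin 42 → Fin 3 → List (Vec (Fin 3) 42) → List (Vec (Fin 3) 42)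
  survivors u c = filter (λ P → ¬? (Vec.lookup P u ≟ c))

  -- A vertex isolated by the triple is an end of its first edge, which leaves two candidates.
  Resolved : Fin 42 → Fin 42 → Fin 42 → List (Vec (Fin 3) 42) → Set
  Resolved u₀ u₁ u₂ L = Any (λ P → Vec.lookup P u₂ ≢ suc (suc zero)) L ⊎
    (Isolates u₀ u₁ u₂ u₀ ⊎ Isolates u₀ u₁ u₂ (ν zero u₀))

  resolved? : ∀ u₀ u₁ u₂ L → Dec (Resolved u₀ u₁ u₂ L)
  resolved? u₀ u₁ u₂ L = Any.any? (λ P → ¬? (Vec.lookup P u₂ ≟ suc (suc zero))) L
    ⊎-dec (iso? u₀ u₁ u₂ u₀ ⊎-dec iso? u₀ u₁ u₂ (ν zero u₀))

  check₂ : Fin 42 → Fin 42 → List (Vec (Fin 3) 42) → Bool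
  check₂ u₀ u₁ L = every (λ u₂ → does (resolved? u₀ u₁ u₂ L))

  check₁ : Fin 42 → List (Vec (Fin 3) 42) → Bool
  check₁ u₀ L = every (λ u₁ → check₂ u₀ u₁ (survivors u₁ (suc zero) L))

  abstract
    check₀ : every (λ u₀ → check₁ u₀ (survivors u₀ zero family)) ≡ true
    check₀ = refl

  partner : Fin 4 → Fin 42 → Fin 42
  partner zero = ν zero
  partner (suc zero) = ν (suc zero)
  partner (suc (suc zero)) = ν (suc (suc zero))
  partner (suc (suc (suc zero))) u = u

  -- The hole at h moves along the edge of colour d and then along the matching edge found there.
  move : Fin 42 × Colours → Fin 3 → Fin 42 × Colours
  move (h , P) d = z₂ , ((P [ h ]≔ colour d) [ z ]≔ colour d) [ z₂ ]≔ hole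
    where
    z z₂ : Fin 42
    z = ν d h
    z₂ = partner (Vec.lookup P z) z

  trace : ℕ → ℕ → Fin 42 × Colours → List (Fin 42 × Colours)
  trace zero _ _ = []
  trace (suc n) w s = s ∷ trace n (w / 10) (move s (digit (w % 10)))

  pick : Fin 42 → List (Fin 42 × Colours) → Colours
  -- The vector of holes only is rejected by `valid`, so a vertex missed by a walk makes the check
  -- fail.
  pick y [] = replicate 42 hole
  pick y ((h , P) ∷ L) = if toℕ h ≡ᵇ toℕ y then P else pick y L

  -- For each x, a walk of the second hole through all vertices other than x, starting from the matching of one colour
  -- (the first digit) with the edge at x removed.
  walks : Vec ℕ 42
  walks = 2223121131112211213312213223322233233233233321
    ∷ 33211333233111233333233211122111311211212211223
    ∷ 32311111123111111131112233223222331123223223221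
    ∷ 2211211212223213332222131311331111313222313112
    ∷ 113323121113331111223212313311222332232233233231
    ∷ 211132113312211112212311233233233233333232332221
    ∷ 112233211333213311122123111111223332332333233221
    ∷ 1111311121111133222223221111322111133233222221
    ∷ 23322322332223132112211221221133131313313313132
    ∷ 1231223331111312111111212232222332332332323331
    ∷ 2323313311221211213312133322332333232332333221
    ∷ 211132211231211211133131233332122332333222223331
    ∷ 3211211331233111322111213332332132332333232331
    ∷ 313321123331221133123332222331221122112211223
    ∷ 21113211322131312222123222221113133113313111332
    ∷ 333113111111211231332222231331112222323322332221
    ∷ 11113221111313311111112222222232223223223221
    ∷ 112231211121113211112123332323233311323322222321
    ∷ 31322132222222222322222112313313311313313311332
    ∷ 11132212311331331211331223233222223223223332231
    ∷ 31112111321112211333123123112323112322332332331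
    ∷ 2133221233312213332322111321311331311113111132
    ∷ 3113213113311322311111222322232223321132223321
    ∷ 221111133111111331212211232112322333233323233231
    ∷ 222222132222222213111111111331122223133131112
    ∷ 313311111211311221322223111132322322232232231
    ∷ 2222222211223233331131331313122322111331112
    ∷ 2111231221121132233332232123311131313133133132
    ∷ 212222223233233212212211131313313113311133112
    ∷ 1133211132122123321331122112233233323322333231
    ∷ 12222133233221322332111111121133231311133131132
    ∷ 1131322113313212212133223323332312332332332231
    ∷ 11233321111211211133111312233233233322332323331
    ∷ 21322121112112213323332123311133113313133131332
    ∷ 221222222133132211222331112333312331133131131312
    ∷ 11131111122233211132212233221311333233222222331
    ∷ 11132132133121331221131223222221332233233233231
    ∷ 21112233231121332211331122331331233211313313312
    ∷ 2211232232222222211311133323213113113131133132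
    ∷ 21131322211111312132231113232222322333122232221
    ∷ 331131111132113132222232232221112232233233221
    ∷ 122312332332221333321112313131311131311133112
    ∷ []

  states : Fin 42 → List (Fin 42 × Colours)
  -- The bound 50 covers every walk. Beyond its last digit a walk goes on with zeros, read as the
  -- third colour; as `pick` takes the first visit, these extra states displace nothing.
  states x = trace 50 (w / 10) (h , (replicate 42 (colour c) [ x ]≔ hole) [ h ]≔ hole)
    where
    w : ℕ
    w = Vec.lookup walks x
    c : Fin 3
    c = digit (w % 10)
    h : Fin 42
    h = ν c x

  Matched : Fin 42 → Fin 42 → Colours → Fin 42 → Fin 4 → Set
  Matched x y P u (suc (suc (suc zero))) = u ≡ x ⊎ u ≡ y
  Matched x y P u c = Vec.lookup P (partner c u) ≡ c

  matched? : ∀ x y P u c → Dec (Matched x y P u c)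
  matched? x y P u zero = Vec.lookup P (ν zero u) ≟ zero
  matched? x y P u (suc zero) = Vec.lookup P (ν (suc zero) u) ≟ suc zero
  matched? x y P u (suc (suc zero)) = Vec.lookup P (ν (suc (suc zero)) u) ≟ suc (suc zero)
  matched? x y P u (suc (suc (suc zero))) = (u ≟ x) ⊎-dec (u ≟ y)

  valid : Fin 42 → Fin 42 → Colours → Bool
  valid x y P = does (Vec.lookup P x ≟ hole) ∧ (does (Vec.lookup P y ≟ hole) ∧ every (λ u → does (matched? x y P u (Vec.lookup P u))))

  check : Fin 42 → List (Fin 42 × Colours) → Bool
  check x L = every (λ y → does (x ≟ y) ∨ valid x y (pick y L))

  abstract
    check-all : every (λ x → check x (states x)) ≡ true
    check-all = refl

  does-sound : ∀ {A : Set} (d : Dec A) → does d ≡ true → A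
  does-sound (yes a) _ = a

  ∧-true : ∀ {a b} → a ∧ b ≡ true → a ≡ true × b ≡ true
  ∧-true {true} {true} _ = refl , refl

  ∨-true : ∀ {a b} → a ∨ b ≡ true → a ≡ true ⊎ b ≡ true
  ∨-true {true} _ = inj₁ refl
  ∨-true {false} p = inj₂ p

  decode-near : ∀ {x y} P → x ≢ y → Vec.lookup P x ≡ hole → Vec.lookup P y ≡ hole →
                (∀ u → Matched x y P u (Vec.lookup P u)) → NearPerfect E x y
  decode-near {x} {y} P x≢y Px Py ok = record
    { m = m ; g≢h = x≢y ; mg = cong (λ c → partner c x) Px ; mh = cong (λ c → partner c y) Py
    ; invo = λ u → back u (Vec.lookup P u) refl (ok u) ; good = λ u p q → edge' u p q (Vec.lookup P u) (ok u) }
    where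
    m : Fin 42 → Fin 42
    m u = partner (Vec.lookup P u) u
    back : ∀ u c → Vec.lookup P u ≡ c → Matched x y P u c → m (partner c u) ≡ u
    back u zero _ p = trans (cong (λ c → partner c (ν zero u)) p) (ν-inv zero u)
    back u (suc zero) _ p = trans (cong (λ c → partner c (ν (suc zero) u)) p) (ν-inv (suc zero) u)
    back u (suc (suc zero)) _ p = trans (cong (λ c → partner c (ν (suc (suc zero)) u)) p) (ν-inv (suc (suc zero)) u)
    back u (suc (suc (suc zero))) q _ = cong (λ c → partner c u) q
    edge' : ∀ u → u ≢ x → u ≢ y → ∀ c → Matched x y P u c → E u (partner c u)
    edge' u _ _ zero _ = edge zero u
    edge' u _ _ (suc zero) _ = edge (suc zero) u
    edge' u _ _ (suc (suc zero)) _ = edge (suc (suc zero)) u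
    edge' u p _ (suc (suc (suc zero))) (inj₁ q) = ⊥-elim (p q)
    edge' u _ p (suc (suc (suc zero))) (inj₂ q) = ⊥-elim (p q)

  valid-near : ∀ {x y} P → x ≢ y → valid x y P ≡ true → NearPerfect E x y
  valid-near {x} {y} P x≢y v =
    let (p , q) = ∧-true {does (Vec.lookup P x ≟ hole)} v
        (r , s) = ∧-true {does (Vec.lookup P y ≟ hole)} q
    in decode-near P x≢y (does-sound (Vec.lookup P x ≟ hole) p) (does-sound (Vec.lookup P y ≟ hole) r)
         (λ u → does-sound (matched? x y P u (Vec.lookup P u)) (every-sound (λ u → does (matched? x y P u (Vec.lookup P u))) s u))

  checked : ∀ {x y} L → x ≢ y → check x L ≡ true → NearPerfect E x y
  checked {x} {y} L x≢y p
    with ∨-true {does (x ≟ y)} (every-sound (λ y → does (x ≟ y) ∨ valid x y (pick y L)) p y)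
  ... | inj₁ q = ⊥-elim (x≢y (does-sound (x ≟ y) q))
  ... | inj₂ q = valid-near (pick y L) x≢y q

  abstract
    bicritical₂ : Bicritical (DCell 2)
    bicritical₂ {x} x≢y = checked (states x) x≢y (every-sound (λ x → check x (states x)) check-all x)

    avoidable : ∀ u₀ u₁ u₂ → (∃ λ P → Proper P × Avoids u₀ u₁ u₂ P) ⊎ ∃ (Isolates u₀ u₁ u₂)
    avoidable u₀ u₁ u₂ = conclude (does-sound (resolved? u₀ u₁ u₂ L₁)
      (every-sound (λ u₂ → does (resolved? u₀ u₁ u₂ L₁))
        (every-sound (λ u₁ → check₂ u₀ u₁ (survivors u₁ (suc zero) L₀))
          (every-sound (λ u₀ → check₁ u₀ (survivors u₀ zero family)) check₀ u₀) u₁) u₂))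
      where
      L₀ L₁ : List (Vec (Fin 3) 42)
      L₀ = survivors u₀ zero family
      L₁ = survivors u₁ (suc zero) L₀
      conclude : Resolved u₀ u₁ u₂ L₁ → (∃ λ P → Proper P × Avoids u₀ u₁ u₂ P) ⊎ ∃ (Isolates u₀ u₁ u₂)
      conclude (inj₂ (inj₁ p)) = inj₂ (_ , p)
      conclude (inj₂ (inj₂ p)) = inj₂ (_ , p)
      conclude (inj₁ p) =
        let (P , P∈L₁ , p₂) = find p
            (P∈L₀ , p₁) = ∈-filter⁻ (λ P → ¬? (Vec.lookup P u₁ ≟ suc zero)) {xs = L₀} P∈L₁
            (P∈ , p₀) = ∈-filter⁻ (λ P → ¬? (Vec.lookup P u₀ ≟ zero)) {xs = family} P∈L₀
        in inj₁ (P , All.lookup family-proper P∈ , p₀ , p₁ , p₂)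

open D₂ using (avoidable; bicritical₂)

unique-lookup : ∀ {A : Set} {L : List A} → Unique L → ∀ i j → lookup L i ≡ lookup L j → i ≡ j
unique-lookup (_ ∷ _) zero zero _ = refl
unique-lookup {L = _ ∷ L} (p ∷ _) zero (suc j) e = ⊥-elim (All.lookup p (∈-lookup {xs = L} j) e)
unique-lookup {L = _ ∷ L} (p ∷ _) (suc i) zero e = ⊥-elim (All.lookup p (∈-lookup {xs = L} i) (sym e))
unique-lookup (_ ∷ q) (suc i) (suc j) e = cong suc (unique-lookup q i j e)

sum-indicator : ∀ {A : Set} (b : A → Bool) L →
                sum (map (λ v → if b v then 1 else 0) L) ≡ length (filter (λ v → T? (b v)) L)
sum-indicator b [] = refl
sum-indicator b (x ∷ L) with b x
... | true = cong suc (sum-indicator b L)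
... | false = sum-indicator b L

-- The graph-theoretic quantities of the statement

module Graph {N r : ℕ} (adj : Fin N → Fin N → Bool) (G : Coloured (Fin N) (suc (suc (suc r))))
             (to : ∀ {u v} → T (adj u v) → Coloured.E G u v) (from : ∀ {u v} → Coloured.E G u v → T (adj u v)) where
  open Coloured G

  private
    d : ℕ
    d = suc (suc (suc r))

  ν-edge : ∀ c u → T (adj u (ν c u))
  ν-edge c u = from (edge c u)

  deg-regular : ∀ u → deg adj u ≡ d
  deg-regular u = trans (sum-indicator (adj u) (allFin N)) (ℕ.≤-antisym
      (injective⇒≤ {f = λ i → proj₁ (colour i)} (λ {i} {j} e →
        unique-lookup (Unique.filter⁺ (λ v → T? (adj u v)) (Unique.allFin⁺ N)) i j
          (trans (sym (proj₂ (colour i))) (trans (cong (λ c → ν c u) e) (proj₂ (colour j))))))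
      (injective⇒≤ {f = λ c → index (mem c)} (λ {c} {c'} e →
        ν-col (trans (lookup-index (mem c)) (trans (cong (lookup nbrs) e) (sym (lookup-index (mem c'))))))))
    where
    nbrs : List (Fin N)
    nbrs = filter (λ v → T? (adj u v)) (allFin N)
    colour : ∀ i → E u (lookup nbrs i)
    colour i = to (proj₂ (∈-filter⁻ (λ v → T? (adj u v)) {xs = allFin N} (∈-lookup {xs = nbrs} i)))
    mem : ∀ c → ν c u ∈ nbrs
    mem c = ∈-filter⁺ (λ v → T? (adj u v)) (∈-allFin (ν c u)) (ν-edge c u)

  pred-sum : pred d + pred d ≡ 2 * pred d
  pred-sum = cong (pred d +_) (sym (ℕ.+-identityʳ (pred d)))

  yG-path : ∀ {u v w} → Path2 adj u v w → yG adj u w ≡ 0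
  yG-path {u} {v} {w} (p , q , _) with adj u w in eq
  ... | false = refl
  ... | true = ⊥-elim (no3 (to p) (to q) (E-sym (to (subst T (sym eq) tt))))

  -- All degrees are `d`, and without triangles the ends of a path of length 2 are not adjacent, so
  -- every such path attains the minimum.
  veVal-path : ∀ {u v w} → Path2 adj u v w → veVal adj u w ≡ 2 * pred d
  veVal-path {u} {v} {w} p = trans (cong₂ _∸_ (cong (_∸ 2) (cong₂ _+_ (deg-regular u) (deg-regular w))) (yG-path p))
    (trans (cong (_∸ 1) (ℕ.+-suc (pred d) (pred d))) pred-sum)

  module _ (u : Fin N) where
    private
      v w : Fin N
      v = ν zero u
      w = ν (suc zero) v

      u≢w : u ≢ w
      u≢w p with ν-col {zero} {suc zero} {v} (trans (ν-inv zero u) p)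
      ... | ()

      eu ew : Fin (pred d) → Fin N × Fin N
      eu c = u , ν (punchIn zero c) u
      ew c = w , ν (punchIn (suc zero) c) w

    path : Path2 adj u v w
    path = ν-edge zero u , ν-edge (suc zero) v , u≢w

    isolating : EdgeList adj
    isolating = tabulate eu ++ tabulate ew

    isolating-length : length isolating ≡ 2 * pred d
    isolating-length = trans (length-++ (tabulate eu))
      (trans (cong₂ _+_ (length-tabulate eu) (length-tabulate ew)) pred-sum)

    private
      member : ∀ {a b} → (a , b) ∈ isolating → (∃ λ c → (a , b) ≡ eu c) ⊎ (∃ λ c → (a , b) ≡ ew c)
      member p with ∈-++⁻ (tabulate eu) p
      ... | inj₁ q = inj₁ (∈-tabulate⁻ q)
      ... | inj₂ q = inj₂ (∈-tabulate⁻ q)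

      memberF : ∀ {a b} → InF adj isolating a b → a ≡ u ⊎ a ≡ w ⊎ b ≡ u ⊎ b ≡ w
      memberF (inj₁ p) with member p
      ... | inj₁ (_ , refl) = inj₁ refl
      ... | inj₂ (_ , refl) = inj₂ (inj₁ refl)
      memberF (inj₂ p) with member p
      ... | inj₁ (_ , refl) = inj₂ (inj₂ (inj₁ refl))
      ... | inj₂ (_ , refl) = inj₂ (inj₂ (inj₂ refl))

      same-star : ∀ {u c c'} → SameEdge adj (u , ν c u) (u , ν c' u) → c ≡ c'
      same-star (inj₁ (_ , p)) = ν-col p
      same-star (inj₂ (p , _)) = ⊥-elim (ν-irr _ _ (sym p))

    isolating-valid : ValidEdgeSet adj isolating
    isolating-valid =
      All.++⁺ (All.tabulate⁺ (λ c → ν-edge (punchIn zero c) u)) (All.tabulate⁺ (λ c → ν-edge (punchIn (suc zero) c) w)) ,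
      AllPairs.++⁺
        (AllPairs.tabulate⁺ (λ {i} {j} i≢j s → i≢j (punchIn-injective zero i j (same-star s))))
        (AllPairs.tabulate⁺ (λ {i} {j} i≢j s → i≢j (punchIn-injective (suc zero) i j (same-star s))))
        (All.tabulate⁺ (λ i → All.tabulate⁺ (λ j → apart i j)))
      where
      apart : ∀ i j → ¬ SameEdge adj (eu i) (ew j)
      apart i j (inj₁ (p , _)) = u≢w p
      -- An edge in both halves would join `u` and `w` and close a triangle with `v`.
      apart i j (inj₂ (_ , p)) = no3 (edge zero u) (edge (suc zero) v) (E-sym (punchIn zero i , p))

    private
      only-v : ∀ {a} → Removed adj isolating u a → a ≡ v
      only-v {a} (p , n) with to p
      ... | zero , q = sym q
      ... | suc c , refl = ⊥-elim (n (inj₁ (∈-++⁺ˡ (∈-tabulate⁺ {f = eu} c))))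

      only-v' : ∀ {a} → Removed adj isolating w a → a ≡ v
      only-v' {a} (p , n) with to p
      ... | zero , refl = ⊥-elim (n (inj₁ (∈-++⁺ʳ (tabulate eu) (∈-tabulate⁺ {f = ew} zero))))
      ... | suc zero , q = trans (sym q) (ν-inv (suc zero) v)
      ... | suc (suc c) , refl = ⊥-elim (n (inj₁ (∈-++⁺ʳ (tabulate eu) (∈-tabulate⁺ {f = ew} (suc c)))))

      uv-kept : ¬ InF adj isolating u v
      uv-kept (inj₁ p) with member p
      ... | inj₁ (c , q) = punchInᵢ≢i zero c (sym (ν-col (cong proj₂ q)))
      ... | inj₂ (c , q) = u≢w (cong proj₁ q)
      uv-kept (inj₂ p) with member p
      ... | inj₁ (c , q) = ν-irr zero u (cong proj₁ q)
      ... | inj₂ (c , q) = ν-irr (suc zero) v (sym (cong proj₁ q))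

      wv-kept : ¬ InF adj isolating w v
      wv-kept (inj₁ p) with member p
      ... | inj₁ (c , q) = u≢w (sym (cong proj₁ q))
      ... | inj₂ (c , q) = punchInᵢ≢i (suc zero) c (ν-col (trans (sym (cong proj₂ q)) (sym (ν-inv (suc zero) v))))
      wv-kept (inj₂ p) with member p
      ... | inj₁ (c , q) = ν-irr zero u (cong proj₁ q)
      ... | inj₂ (c , q) = ν-irr (suc zero) v (sym (cong proj₁ q))

    private
      Towards : Fin N → Fin d → Fin 2 → Set
      Towards a c zero = ν c a ≡ u
      Towards a c (suc zero) = ν c a ≡ w

      Towards-uniq : ∀ {a c c' e} → Towards a c e → Towards a c' e → c ≡ c'
      Towards-uniq {e = zero} p q = ν-col (trans p (sym q))
      Towards-uniq {e = suc zero} p q = ν-col (trans p (sym q))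

    -- After the deletion `v` is the only neighbour of both `u` and `w`, and it cannot be the
    -- partner of both.
    isolating-conditional : CondFaultSet adj isolating
    isolating-conditional = no-matching , not-isolated
      where
      no-matching : ¬ PerfectMatching (Removed adj isolating)
      no-matching (m , ok) = u≢w (trans (sym (proj₂ (ok u))) (trans (cong m (only-v (proj₁ (ok u))))
        (trans (cong m (sym (only-v' (proj₁ (ok w))))) (proj₂ (ok w)))))
      -- At most two of the d ≥ 3 edges at a go to u or w.
      not-isolated : ∀ a → ¬ Isolated (Removed adj isolating) a
      not-isolated a iso with a ≟ u | a ≟ w
      ... | yes refl | _ = iso v (ν-edge zero u , uv-kept)
      ... | no _ | yes refl = iso v (from (edge⁻ (suc zero) v) , wv-kept)
      ... | no a≢u | no a≢w with find-or {P = λ c → ν c a ≢ u × ν c a ≢ w} dec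
        where
        dec : ∀ c → (ν c a ≢ u × ν c a ≢ w) ⊎ ∃ (Towards a c)
        dec c with ν c a ≟ u | ν c a ≟ w
        ... | yes p | _ = inj₂ (zero , p)
        ... | no _ | yes p = inj₂ (suc zero , p)
        ... | no p | no q = inj₁ (p , q)
      ...   | inj₁ (c , p , q) = iso (ν c a) (ν-edge c a , λ h →
                [ a≢u , [ a≢w , [ p , q ]′ ]′ ]′ (memberF h))
      ...   | inj₂ all = ℕ.<⇒≱ (s≤s (s≤s (s≤s z≤n))) (bound (choose all Towards-uniq))

    isolating-solution : Σ (EdgeList adj) λ F → ValidEdgeSet adj F × length F ≡ 2 * pred d × CondFaultSet adj F
    isolating-solution = isolating , isolating-valid , isolating-length , isolating-conditional

    ve : IsVe adj (2 * pred d)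
    ve = (u , v , w , path , veVal-path path) , λ _ _ _ p → ℕ.≤-reflexive (sym (veVal-path p))

  module _ (F : EdgeList adj) where
    open Faults G _≟_ F

    InF-hit : ∀ {u c} → InF adj F u (ν c u) → Hit u c
    InF-hit (inj₁ p) = index p , inj₁ (sym (lookup-index p))
    InF-hit (inj₂ p) = index p , inj₂ (sym (lookup-index p))

    hit-InF : ∀ {u c} → Hit u c → InF adj F u (ν c u)
    hit-InF {u} {c} (e , inj₁ p) = inj₁ (subst (_∈ F) p (∈-lookup {xs = F} e))
    hit-InF {u} {c} (e , inj₂ p) = inj₂ (subst (_∈ F) p (∈-lookup {xs = F} e))

    InF-sym : ∀ {a b} → InF adj F a b → InF adj F b a
    InF-sym (inj₁ p) = inj₂ p
    InF-sym (inj₂ p) = inj₁ p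

    not-perfect : CondFaultSet adj F → ¬ Perfect Good
    not-perfect (no-pm , _) (m , ok) = no-pm (m , λ u → removed (proj₁ (ok u)) , proj₂ (ok u))
      where
      removed : ∀ {a b} → Good a b → Removed adj F a b
      removed (c , refl , n) = ν-edge c _ , λ h → n (InF-hit h)

    good-edges : CondFaultSet adj F → ∀ u → ∃ λ c → ¬ Hit u c
    good-edges (_ , no-iso) u with find-or dec
      where
      dec : ∀ c → ¬ Hit u c ⊎ Hit u c
      dec c with hit? u c
      ... | yes h = inj₂ h
      ... | no h = inj₁ h
    ... | inj₁ p = p
    ... | inj₂ all = ⊥-elim (no-iso u λ a (p , n) → n (hit-edge (to p)))
      where
      hit-edge : ∀ {a} → E u a → InF adj F u a
      hit-edge (c , refl) = hit-InF (all c)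

    star-trivial : Star → TrivialSolution adj F
    star-trivial st = u , v , w , path' , subst (IsVe adj) (sym (veVal-path path')) (ve u) , λ a b → mk⇔ forth back
      where
      open Star st renaming (centre to u)
      v w : Fin N
      v = ν c u
      w = ν c' v

      u≢w : u ≢ w
      u≢w p = c≢c' (ν-col {c} {c'} {v} (trans (ν-inv c u) p))

      path' : Path2 adj u v w
      path' = ν-edge c u , ν-edge c' v , u≢w

      Trivial : Fin N → Fin N → Set
      Trivial a b = Edge adj a b × (a ≡ u ⊎ a ≡ w ⊎ b ≡ u ⊎ b ≡ w)
        × ¬ SameEdge adj (a , b) (u , v) × ¬ SameEdge adj (a , b) (v , w)

      at-u : ∀ x → x ≢ c → Trivial u (ν x u)
      at-u x x≢c = ν-edge x u , inj₁ refl
        , [ (λ (_ , q) → x≢c (ν-col q)) , (λ (q , _) → ν-irr c u (sym q)) ]′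
        , [ (λ (q , _) → ν-irr c u (sym q)) , (λ (q , _) → u≢w q) ]′

      at-w : ∀ x → x ≢ c' → Trivial w (ν x w)
      at-w x x≢c' = ν-edge x w , inj₂ (inj₁ refl)
        , [ (λ (q , _) → u≢w (sym q)) , (λ (q , _) → ν-irr c' v q) ]′
        , [ (λ (q , _) → ν-irr c' v q) , (λ (_ , q) → x≢c' (ν-col (trans q (sym (ν-inv c' v))))) ]′

      flip : ∀ {a b} → Trivial a b → Trivial b a
      flip (p , q , r , s) = from (E-sym (to p))
        , [ (λ x → inj₂ (inj₂ (inj₁ x))) , [ (λ x → inj₂ (inj₂ (inj₂ x))) , [ inj₁ , (λ x → inj₂ (inj₁ x)) ]′ ]′ ]′ q
        , (λ x → r (turn x)) , (λ x → s (turn x))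
        where
        turn : ∀ {a b x y} → SameEdge adj (b , a) (x , y) → SameEdge adj (a , b) (x , y)
        turn (inj₁ (p , q)) = inj₂ (q , p)
        turn (inj₂ (p , q)) = inj₁ (q , p)

      from-edge : ∀ {a b x y e} → IsEdge e x y → lookup F e ≡ (a , b) → Trivial x y → Trivial a b
      from-edge (inj₁ p) q t with trans (sym q) p
      ... | refl = t
      from-edge (inj₂ p) q t with trans (sym q) p
      ... | refl = flip t

      listed : ∀ {a b} → (a , b) ∈ F → Trivial a b
      listed p with cover (index p)
      ... | inj₁ (x , x≢c , q) = from-edge q (sym (lookup-index p)) (at-u x x≢c)
      ... | inj₂ (x , x≢c' , q) = from-edge q (sym (lookup-index p)) (at-w x x≢c')

      forth : ∀ {a b} → InF adj F a b → Trivial a b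
      forth (inj₁ p) = listed p
      forth (inj₂ p) = flip (listed p)

      from-u : ∀ {b} → Trivial u b → InF adj F u b
      from-u (p , _ , r , _) with to p
      ... | x , refl with x ≟ c
      ...   | yes refl = ⊥-elim (r (inj₁ (refl , refl)))
      ...   | no x≢c = hit-InF (hit-u x x≢c)

      from-w : ∀ {b} → Trivial w b → InF adj F w b
      from-w (p , _ , _ , s) with to p
      ... | x , refl with x ≟ c'
      ...   | yes refl = ⊥-elim (s (inj₂ (refl , ν-inv c' v)))
      ...   | no x≢c' = hit-InF (hit-w x x≢c')

      back : ∀ {a b} → Trivial a b → InF adj F a b
      back t@(_ , inj₁ refl , _) = from-u t
      back t@(_ , inj₂ (inj₁ refl) , _) = from-w t
      back t@(_ , inj₂ (inj₂ (inj₁ refl)) , _) = InF-sym (from-u (flip t))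
      back t@(_ , inj₂ (inj₂ (inj₂ refl)) , _) = InF-sym (from-w (flip t))

-- Agreement of the colouring with the adjacency of the DCell

punchIn-low : ∀ {n} (i : Fin (suc n)) j → toℕ j < toℕ i → toℕ (punchIn i j) ≡ toℕ j
punchIn-low (suc i) zero _ = refl
punchIn-low (suc i) (suc j) (s≤s p) = cong suc (punchIn-low i j p)

punchIn-high : ∀ {n} (i : Fin (suc n)) j → toℕ i ≤ toℕ j → toℕ (punchIn i j) ≡ suc (toℕ j)
punchIn-high zero j _ = refl
punchIn-high (suc i) (suc j) (s≤s p) = cong suc (punchIn-high i j p)

module _ {T' : ℕ} where
  open Cross T'

  -- `punchIn` shifts by one exactly the indices from the skipped copy on. This shift accounts for
  -- the asymmetry between b - 1 in the lower copy and a in the upper one.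
  χ-ordered : ∀ {i j i' j'} → toℕ i < toℕ i' → toℕ j ≡ toℕ i' ∸ 1 → toℕ j' ≡ toℕ i → χ (i , j) ≡ (i' , j')
  χ-ordered {i} {j} {suc i'} {j'} i<i' hj hj' = tgt-inj there-eq (trans (tgt-χ (i , j)) (sym back-eq))
    where
    there-eq : punchIn i j ≡ suc i'
    there-eq = toℕ-injective (trans (punchIn-high i j (subst (toℕ i ≤_) (sym hj) (ℕ.≤-pred i<i'))) (cong suc hj))
    back-eq : punchIn (suc i') j' ≡ i
    back-eq = toℕ-injective (trans (punchIn-low (suc i') j' (subst (_< suc (toℕ i')) (sym hj') i<i')) hj')

  χ-ordered⁻ : ∀ {i j i' j'} → χ (i , j) ≡ (i' , j') → toℕ i < toℕ i' → toℕ j ≡ toℕ i' ∸ 1 × toℕ j' ≡ toℕ i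
  χ-ordered⁻ {i} {j} {i'} {j'} eq i<i' with ℕ.<-≤-connex (toℕ j) (toℕ i) | ℕ.<-≤-connex (toℕ j') (toℕ i')
  ... | inj₁ p | _ = ⊥-elim (ℕ.<-asym i<i' (subst (_< toℕ i)
          (trans (sym (punchIn-low i j p)) (cong (λ u → toℕ (proj₁ u)) eq)) p))
  ... | inj₂ p | inj₁ q = cong (_∸ 1) (trans (sym (punchIn-high i j p)) (cong (λ u → toℕ (proj₁ u)) eq)) ,
          trans (sym (punchIn-low i' j' q)) (cong toℕ (trans (cong tgt (sym eq)) (tgt-χ (i , j))))
  ... | inj₂ p | inj₂ q = ⊥-elim (ℕ.<-asym i<i' (subst (toℕ i' <_)
          (trans (sym (punchIn-high i' j' q)) (cong toℕ (trans (cong tgt (sym eq)) (tgt-χ (i , j))))) (s≤s q)))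

≡ᵇ-true : ∀ {a b} → (a ≡ᵇ b) ≡ true → a ≡ b
≡ᵇ-true p = ℕ.≡ᵇ⇒≡ _ _ (subst T (sym p) tt)

≡ᵇ-false : ∀ {a b} → (a ≡ᵇ b) ≡ false → a ≢ b
≡ᵇ-false p q = subst T p (ℕ.≡⇒≡ᵇ _ _ q)

<ᵇ-true : ∀ {a b} → (a <ᵇ b) ≡ true → a < b
<ᵇ-true p = ℕ.<ᵇ⇒< _ _ (subst T (sym p) tt)

<ᵇ-false : ∀ {a b} → (a <ᵇ b) ≡ false → a ≢ b → b < a
<ᵇ-false p q = ℕ.≤∧≢⇒< (ℕ.≮⇒≥ (λ r → subst T p (ℕ.<⇒<ᵇ r))) (λ r → q (sym r))

module _ {S : ℕ} {r : ℕ} (H : Coloured (Fin S) r) (adj : Fin S → Fin S → Bool)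
         (to : ∀ {u v} → T (adj u v) → Coloured.E H u v) (from : ∀ {u v} → Coloured.E H u v → T (adj u v)) where
  open Product H

  product-adj : P → P → Bool
  product-adj (i , j) (i' , j') =
    if toℕ i ≡ᵇ toℕ i'
      then adj j j'
      else (if toℕ i <ᵇ toℕ i'
        then ((toℕ j ≡ᵇ (toℕ i' ∸ 1)) ∧ (toℕ j' ≡ᵇ toℕ i))
        else ((toℕ j' ≡ᵇ (toℕ i ∸ 1)) ∧ (toℕ j ≡ᵇ toℕ i')))

  product-to : ∀ u v → T (product-adj u v) → EP u v
  product-to (i , j) (i' , j') p with toℕ i ≡ᵇ toℕ i' in eq
  ... | true with toℕ-injective {i = i} {i'} (≡ᵇ-true eq) | to p
  ...   | refl | c , refl = suc c , refl
  product-to (i , j) (i' , j') p | false with toℕ i <ᵇ toℕ i' in lt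
  ... | true = let (a , b) = Equivalence.to T-∧ p in
    zero , χ-ordered (<ᵇ-true lt) (ℕ.≡ᵇ⇒≡ _ _ a) (ℕ.≡ᵇ⇒≡ _ _ b)
  ... | false = let (a , b) = Equivalence.to T-∧ p in
    zero , trans (cong χ (sym (χ-ordered (<ᵇ-false lt (≡ᵇ-false eq)) (ℕ.≡ᵇ⇒≡ _ _ a) (ℕ.≡ᵇ⇒≡ _ _ b)))) (χ-inv (i' , j'))

  product-from : ∀ u v → EP u v → T (product-adj u v)
  product-from (i , j) (i' , j') (c , p) with toℕ i ≡ᵇ toℕ i' in eq
  product-from (i , j) (i' , j') (zero , p) | true =
    ⊥-elim (tgt≢ (i , j) (trans (cong proj₁ p) (sym (toℕ-injective (≡ᵇ-true eq)))))
  product-from (i , j) (i' , j') (suc c , p) | true = from (c , cong proj₂ p)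
  product-from (i , j) (i' , j') (suc c , p) | false = ⊥-elim (≡ᵇ-false eq (cong (λ u → toℕ (proj₁ u)) p))
  product-from (i , j) (i' , j') (zero , p) | false with toℕ i <ᵇ toℕ i' in lt
  ... | true = let (a , b) = χ-ordered⁻ p (<ᵇ-true lt) in
    Equivalence.from T-∧ (ℕ.≡⇒≡ᵇ _ _ a , ℕ.≡⇒≡ᵇ _ _ b)
  ... | false = let (a , b) = χ-ordered⁻ (trans (cong χ (sym p)) (χ-inv (i , j))) (<ᵇ-false lt (≡ᵇ-false eq)) in
    Equivalence.from T-∧ (ℕ.≡⇒≡ᵇ _ _ a , ℕ.≡⇒≡ᵇ _ _ b)

adj-to : ∀ k {u v} → T (DCellAdj k 2 u v) → Coloured.E (DCell k) u v
adj-from : ∀ k {u v} → Coloured.E (DCell k) u v → T (DCellAdj k 2 u v)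

adj-to zero {zero} {suc zero} _ = zero , refl
adj-to zero {suc zero} {zero} _ = zero , refl
adj-to zero {suc zero} {suc zero} ()
adj-to (suc k) {u} {v} p = Transport.push merge split split-merge merge-split (Product.product (DCell k))
  (product-to (DCell k) (DCellAdj k 2) (adj-to k) (adj-from k) (split u) (split v) p)
  where open Uid (t k 2)

adj-from zero {zero} (zero , refl) = tt
adj-from zero {suc zero} (zero , refl) = tt
adj-from (suc k) {u} {v} p = product-from (DCell k) (DCellAdj k 2) (adj-to k) (adj-from k) (split u) (split v)
  (Transport.pull merge split split-merge merge-split (Product.product (DCell k)) p)
  where open Uid (t k 2)

-- Faults under relabelling

module _ {A B : Set} (f : A → B) where
  map-index : ∀ L (e : Fin (length L)) → ∃ λ e' → lookup (map f L) e' ≡ f (lookup L e)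
  map-index (_ ∷ L) zero = zero , refl
  map-index (_ ∷ L) (suc e) = let (e' , p) = map-index L e in suc e' , p

  map-index⁻ : ∀ L (e' : Fin (length (map f L))) → ∃ λ e → lookup (map f L) e' ≡ f (lookup L e)
  map-index⁻ (_ ∷ L) zero = zero , refl
  map-index⁻ (_ ∷ L) (suc e') = let (e , p) = map-index⁻ L e' in suc e , p

module TransportFaults {A B : Set} {r : ℕ} (f : A → B) (g : B → A) (gf : ∀ a → g (f a) ≡ a) (fg : ∀ b → f (g b) ≡ b)
    (G : Coloured A r) (_≟A_ : DecidableEquality A) (_≟B_ : DecidableEquality B) (F : List (B × B)) where
  g² : B × B → A × A
  g² (u , v) = g u , g v

  private
    module FB = Faults (Transport.transport f g gf fg G) _≟B_ F
    module FA = Faults G _≟A_ (map g² F)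
    module G = Coloured G
    open Transport f g gf fg using (νB)

    pulled : ∀ {x u v} → g² x ≡ (u , v) → x ≡ (f u , f v)
    pulled {x , y} p with ,-injective p
    ... | q , s = cong₂ _,_ (trans (sym (fg x)) (cong f q)) (trans (sym (fg y)) (cong f s))

    lower : ∀ {e e' a c} → lookup (map g² F) e' ≡ g² (lookup F e) → FA.By a c e' → FB.By (f a) c e
    lower {a = a} {c} p (inj₁ q) = inj₁ (trans (pulled (trans (sym p) q))
      (cong (f a ,_) (cong (λ x → f (G.ν c x)) (sym (gf a)))))
    lower {a = a} {c} p (inj₂ q) = inj₂ (trans (pulled (trans (sym p) q))
      (cong (_, f a) (cong (λ x → f (G.ν c x)) (sym (gf a)))))

    raise : ∀ {e e' a c} → lookup (map g² F) e' ≡ g² (lookup F e) → FB.By (f a) c e → FA.By a c e'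
    raise {a = a} {c} p (inj₁ q) = inj₁ (trans p (trans (cong g² q)
      (cong₂ _,_ (gf a) (trans (gf _) (cong (G.ν c) (gf a))))))
    raise {a = a} {c} p (inj₂ q) = inj₂ (trans p (trans (cong g² q)
      (cong₂ _,_ (trans (gf _) (cong (G.ν c) (gf a))) (gf a))))

  lower-hit : ∀ {a c} → FA.Hit a c → FB.Hit (f a) c
  lower-hit (e' , q) = let (e , p) = map-index⁻ g² F e' in e , lower p q

  raise-hit : ∀ {a c} → FB.Hit (f a) c → FA.Hit a c
  raise-hit (e , q) = let (e' , p) = map-index g² F e in e' , raise p q

  lower-perfect : Perfect FA.Good → Perfect FB.Good
  lower-perfect (m , ok) = (λ b → f (m (g b))) , λ b → good (proj₁ (ok (g b))) ,
    trans (cong (λ a → f (m a)) (gf _)) (trans (cong f (proj₂ (ok (g b)))) (fg b))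
    where
    good : ∀ {b a} → FA.Good (g b) a → FB.Good b (f a)
    good {b} (c , p , n) = c , cong f p , λ h → n (raise-hit (subst (λ b → FB.Hit b c) (sym (fg b)) h))

  lower-noiso : (∀ b → ∃ λ c → ¬ FB.Hit b c) → ∀ a → ∃ λ c → ¬ FA.Hit a c
  lower-noiso ni a = let (c , n) = ni (f a) in c , λ h → n (lower-hit h)

  lower-star : FA.Star → FB.Star
  lower-star st = record
    { centre = f u ; c = c ; c' = c' ; c≢c' = c≢c'
    ; cover = λ e → cover' (map-index g² F e)
    ; hit-u = λ d p → lower-hit (hit-u d p)
    ; hit-w = λ d p → subst (λ b → FB.Hit b d) w-eq (lower-hit (hit-w d p))
    ; size = subst (pred r + pred r ≤_) (length-map g² F) size }
    where
    open FA.Star st renaming (centre to u)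
    w-eq : f (G.ν c' (G.ν c u)) ≡ νB G c' (νB G c (f u))
    w-eq = cong (λ a → f (G.ν c' a)) (trans (cong (G.ν c) (sym (gf u))) (sym (gf _)))
    cover' : ∀ {e} → (∃ λ e' → lookup (map g² F) e' ≡ g² (lookup F e)) →
             (∃ λ d → d ≢ c × FB.By (f u) d e) ⊎ (∃ λ d → d ≢ c' × FB.By (νB G c' (νB G c (f u))) d e)
    cover' (e' , p) with cover e'
    ... | inj₁ (d , q , s) = inj₁ (d , q , lower p s)
    ... | inj₂ (d , q , s) = inj₂ (d , q , subst (λ b → FB.By b d _) w-eq (lower p s))

-- Enough copies, and the conclusion

t-mono : ∀ k → 4 ≤ t k 2 → t k 2 + 4 ≤ t (suc k) 2
t-mono k 4≤t = ℕ.+-monoʳ-≤ (t k 2) (ℕ.≤-trans 4≤t (ℕ.m≤m*n (t k 2) (t k 2) {{>-nonZero (ℕ.≤-trans (s≤s z≤n) 4≤t)}}))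

room-suc : ∀ n → suc n + suc n + (suc n + suc n + 4) ≡ n + n + (n + n + 4) + 4
room-suc = solve-∀

4≤t : ∀ r → 4 ≤ t (2 + r) 2
-- The requirement of `Routing` starts at 16 against `t 2 2 = 42` and grows by 4 with each level,
-- whereas `t` grows by its square.
many : ∀ r → (3 + r) + (3 + r) + ((3 + r) + (3 + r) + 4) ≤ t (2 + r) 2
many zero = ℕ.m≤m+n 16 26
many (suc r) = ℕ.≤-trans (ℕ.≤-reflexive (room-suc (3 + r)))
  (ℕ.≤-trans (ℕ.+-monoˡ-≤ 4 (many r)) (t-mono (2 + r) (4≤t r)))

4≤t r = ℕ.≤-trans (ℕ.m≤n+m 4 ((3 + r) + (3 + r)))
  (ℕ.≤-trans (ℕ.m≤n+m ((3 + r) + (3 + r) + 4) ((3 + r) + (3 + r))) (many r))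

DCell-bicritical : ∀ r → Bicritical (DCell (2 + r))
DCell-bicritical zero = bicritical₂
DCell-bicritical (suc r) = Transport.transport-bicritical merge split split-merge merge-split
  (Product.product (DCell (2 + r))) (product-bicritical (4≤t r) (DCell (2 + r)) (DCell-bicritical r))
  where open Uid (t (2 + r) 2)

module _ (r : ℕ) (F : List (Fin (t (3 + r) 2) × Fin (t (3 + r) 2))) where
  open Uid (t (2 + r) 2)
  open Faults (DCell (3 + r)) _≟_ F

  matched-or-star : length F ≤ (3 + r) + (3 + r) → (∀ u → ∃ λ c → ¬ Hit u c) → Perfect Good ⊎ Star
  matched-or-star few noiso = [ (λ p → inj₁ (lower-perfect p)) , (λ s → inj₂ (lower-star s)) ]′
      (Solve.perfect-or-star (s≤s (s≤s z≤n)) (DCell (2 + r)) (DCell-bicritical r) (map g² F) room few' (lower-noiso noiso))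
    where
    open TransportFaults merge split split-merge merge-split (Product.product (DCell (2 + r)))
      (≡-dec _≟_ _≟_) _≟_ F
    few' : length (map g² F) ≤ (3 + r) + (3 + r)
    few' = subst (_≤ (3 + r) + (3 + r)) (sym (length-map g² F)) few
    room : length (map g² F) + (length (map g² F) + 4) < suc (t (2 + r) 2)
    room = s≤s (ℕ.≤-trans (ℕ.+-mono-≤ few' (ℕ.+-monoˡ-≤ 4 few')) (many r))

origin : ∀ k → Fin (t k 2)
origin zero = zero
origin (suc k) = Uid.merge (t k 2) (zero , origin k)

module Cell (r : ℕ) = Graph (DCellAdj (2 + r) 2) (DCell (2 + r)) (adj-to (2 + r)) (adj-from (2 + r))

double : ∀ n → 2 * n ≡ n + n
double n = cong (n +_) (ℕ.+-identityʳ n)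

-- One dichotomy serves both claims: below the bound a star is impossible because of its `size`, and
-- at the bound it is the trivial solution. Only D_{2,2} needs the separate treatment of three
-- faults.
mp₁-lower : ∀ r (F : EdgeList (DCellAdj (2 + r) 2)) → CondFaultSet (DCellAdj (2 + r) 2) F → 2 * (2 + r) ≤ length F
mp₁-lower zero F cond = ℕ.≮⇒≥ λ short → Cell.not-perfect 0 F cond
  (ThreeFaults.matched (DCell 2) avoidable F (ℕ.≤-pred short) (Cell.good-edges 0 F cond))
mp₁-lower (suc r) F cond = ℕ.≮⇒≥ λ short →
  [ Cell.not-perfect (suc r) F cond
  , (λ s → ℕ.<⇒≱ (subst (length F <_) (double (3 + r)) short) (Faults.Star.size s)) ]′
  (matched-or-star r F (subst (length F ≤_) (double (3 + r)) (ℕ.<⇒≤ short)) (Cell.good-edges (suc r) F cond))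

is-mp₁ : ∀ r → IsMp1 (DCellAdj (2 + r) 2) (2 * (2 + r))
is-mp₁ r = Cell.isolating-solution r (origin (2 + r)) , λ F _ cond → mp₁-lower r F cond

super-matched : ∀ r → ConditionallySuperMatched (DCellAdj (3 + r) 2)
super-matched r = 2 * (3 + r) , is-mp₁ (suc r) , Cell.ve (suc r) (origin (3 + r)) , λ F _ len cond →
  [ (λ p → ⊥-elim (Cell.not-perfect (suc r) F cond p)) , Cell.star-trivial (suc r) F ]′
  (matched-or-star r F (ℕ.≤-reflexive (trans len (double (3 + r)))) (Cell.good-edges (suc r) F cond))

theorem27 : ((k : ℕ) → 2 ≤ k → IsMp1 (DCellAdj k 2) (2 * k))
          × ((k : ℕ) → 3 ≤ k → ConditionallySuperMatched (DCellAdj k 2))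
theorem27 = (λ { (suc zero) (s≤s ()) ; (suc (suc r)) _ → is-mp₁ r })
          , (λ { (suc zero) (s≤s ()) ; (suc (suc zero)) (s≤s (s≤s ())) ; (suc (suc (suc r))) _ → super-matched r })
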